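{- Let $R$ be a commutative ring with unit, let $n\ge1$, and let $u_1,\dots,u_n\in tR[[t]]$. Let $Q(x,t)\in R((x))((t))$ contain only nonnegative powers of $x$. Then, in $R((x))((t))$, $$\mathop{\mathrm{PT}}_x\ Q(x,t)\prod_{i=1}^n\frac{1}{x-u_i}=\partial_{u_n}\partial_{u_{n-1}}\cdots\partial_{u_1}Q(x,t).$$ In particular, $$\mathop{\mathrm{CT}}_x\ xQ(x,t)\prod_{i=1}^n\frac1{x-u_i}=\sum_{i=1}^nQ(u_i,t)\prod_{1\le j\le n,\ j\ne i}\frac1{u_i-u_j}.$$
   Context: $R((x))((t))$ is the ring of Laurent series in $t$ with coefficients in the ring $R((x))$ of Laurent series in $x$. For $f=\sum_{n\ge n_0}\sum_{m}a_{mn}x^mt^n$ in it, $\mathrm{PT}_xf=\sum_{n\ge n_0}\sum_{m\ge0}a_{mn}x^mt^n$ and $\mathrm{CT}_xf=\sum_{n\ge n_0}a_{0n}t^n$. For $u\in tR[[t]]$, $\frac1{x-u}=x^{ -1}\sum_{k\ge0}u^kx^{ -k}$. The divided difference operator (with respect to $x$) is $\partial_uf(x)=\frac{f(x)-f(u)}{x-u}$, i.e. the linear operator with $\partial_ux^m=\sum_{k=0}^{m-1}x^{m-1-k}u^k$ for $m\ge0$ (applied coefficientwise in $t$). The $u_i$ are allowed to be zero and to coincide; the right-hand side of the second formula is understood as follows: for indeterminates $z_1,\dots,z_n$ the expression $\sum_iQ(z_i,t)\prod_{j\ne i}(z_i-z_j)^{ -1}$ is a series in nonnegative powers of the $z_i$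 (with coefficients Laurent in $t$), and one substitutes $z_i=u_i$. -}

module Defs where

open import Algebra.Bundles using (CommutativeRing)
open import Algebra.Bundles.Raw using (RawRing)
import Algebra.Definitions.RawSemiring as RawSemiringDefinitions
open import Data.Fin.Base using (Fin; zero; suc; toℕ)
open import Data.Integer.Base as ℤ using (ℤ; +_; -[1+_])
open import Data.Nat.Base as ℕ using (ℕ; zero; suc; _∸_)
open import Data.Vec.Functional as Vector using (Vector; removeAt)
open import Function.Base using (_∘_)

module Ops {c ℓ} (A : RawRing c ℓ) where
  open RawRing A public
  open RawSemiringDefinitions rawSemiring public using (sum; product; _^_)

  Σ[0⋯_] : ℕ → (ℕ → Carrier) → Carrier
  Σ[0⋯ k ] f = sum {suc k} (λ i → f (toℕ i))

  cauchy : (ℕ → Carrier) → (ℕ → Carrier) → ℕ → Carrier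
  cauchy f g k = Σ[0⋯ k ] (λ i → f i * g (k ∸ i))

  single : Carrier → ℕ → Carrier
  single a zero    = a
  single a (suc _) = 0#

------------------------------------------------------------------------
-- Formal power series A[[x]]

PowerSeries : ∀ {c ℓ} → RawRing c ℓ → RawRing c ℓ
PowerSeries A = record
  { Carrier = ℕ → Carrier
  ; _≈_     = λ f g → ∀ k → f k ≈ g k
  ; _+_     = λ f g k → f k + g k
  ; _*_     = cauchy
  ; -_      = λ f k → - f k
  ; 0#      = λ _ → 0#
  ; 1#      = single 1#
  }
  where open Ops A

module PowerSeriesOps {c ℓ} (A : RawRing c ℓ) where
  open Ops A

  C : Carrier → ℕ → Carrier
  C = single

  X : ℕ → Carrier
  X zero    = 0#
  X (suc k) = single 1# k

  -- The infinite sum F₀ + F₁ + F₂ + ⋯ of a family of power series such that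
  -- the k-th power of the variable divides F k.  Then F k does not contribute
  -- to the coefficient at l when k > l.  The sum is meaningful only for such
  -- families.
  Σ∞ : (ℕ → ℕ → Carrier) → ℕ → Carrier
  Σ∞ F l = Σ[0⋯ l ] (λ k → F k l)

------------------------------------------------------------------------
-- Formal Laurent series A((x))

infix 3 _⟨_⟩

-- The series  Σ_{k ≥ 0} coeffs k · x^(order + k).  The coefficient at `order`
-- may vanish, so one series has many representations; they are identified by
-- the equality of `Laurent` below.
record LaurentSeries {c} (A : Set c) : Set c where
  constructor _⟨_⟩
  field
    order  : ℤ
    coeffs : ℕ → A

open LaurentSeries public

mapCoeffs : ∀ {a b} {A : Set a} {B : Set b} →
            (A → B) → LaurentSeries A → LaurentSeries B
mapCoeffs φ f = order f ⟨ φ ∘ coeffs f ⟩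

module LaurentOps {c ℓ} (A : RawRing c ℓ) where
  open Ops A

  coeff : LaurentSeries Carrier → ℤ → Carrier
  coeff f m with m ℤ.- order f
  ... | + k      = coeffs f k
  ... | -[1+ _ ] = 0#

  monomial : ℤ → Carrier → LaurentSeries Carrier
  monomial m a = m ⟨ single a ⟩

  const : Carrier → LaurentSeries Carrier
  const = monomial (+ 0)

  fromPowerSeries : (ℕ → Carrier) → LaurentSeries Carrier
  fromPowerSeries f = + 0 ⟨ f ⟩

  -- The part with nonnegative exponents, as a power series.
  nonnegative : LaurentSeries Carrier → ℕ → Carrier
  nonnegative f m = coeff f (+ m)

Laurent : ∀ {c ℓ} → RawRing c ℓ → RawRing c ℓ
Laurent A = record
  { Carrier = LaurentSeries Carrier
  ; _≈_     = λ f g → ∀ m → coeff f m ≈ coeff g m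
  ; _+_     = λ f g → let o = order f ℤ.⊓ order g in
                o ⟨ (λ k → coeff f (o ℤ.+ + k) + coeff g (o ℤ.+ + k)) ⟩
  ; _*_     = λ f g → (order f ℤ.+ order g) ⟨ cauchy (coeffs f) (coeffs g) ⟩
  ; -_      = mapCoeffs -_
  ; 0#      = const 0#
  ; 1#      = const 1#
  }
  where
  open Ops A
  open LaurentOps A

------------------------------------------------------------------------
-- Fractions

module Fractions {c ℓ} (A : RawRing c ℓ) where
  open Ops A

  -- p = Σᵢ aᵢ / dᵢ, after multiplication by the common denominator Πᵢ dᵢ.
  -- This is equality in the total ring of fractions provided that the dᵢ are
  -- not zero divisors.
  _IsSumOfFractions_/_ : ∀ {n} → Carrier →
                         Vector Carrier (suc n) → Vector Carrier (suc n) → Set ℓ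
  p IsSumOfFractions a / d =
    p * product d ≈ sum (λ i → a i * product (removeAt d i))

------------------------------------------------------------------------
-- The rings and operators of the theorem, over a commutative ring R

module Setup {c ℓ} (R : CommutativeRing c ℓ) where

  open CommutativeRing R public using (rawRing) renaming (_≈_ to _≈ᴿ_; 0# to 0ᴿ)
  private module R = Ops rawRing

  R⟦t⟧ R⦅t⦆ R⦅x⦆ R⦅x⦆⦅t⦆ : RawRing c ℓ
  R⟦t⟧    = PowerSeries rawRing
  R⦅t⦆    = Laurent rawRing
  R⦅x⦆    = Laurent rawRing
  R⦅x⦆⦅t⦆ = Laurent R⦅x⦆

  -- R[[z₁,…,zₙ]], as iterated power series; the outermost variable is z₁.
  R⟦z⟧ : ℕ → RawRing c ℓ
  R⟦z⟧ zero    = rawRing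
  R⟦z⟧ (suc n) = PowerSeries (R⟦z⟧ n)

  R⟦z⟧⦅t⦆ : ℕ → RawRing c ℓ
  R⟦z⟧⦅t⦆ n = Laurent (R⟦z⟧ n)

  private
    module Rt     = Ops R⟦t⟧
    module Rt-ps  = PowerSeriesOps rawRing
    module Rx     = LaurentOps rawRing
    module Rxt    = Ops R⦅x⦆⦅t⦆
    module Rxt-ls = LaurentOps R⦅x⦆

  open RawRing using (Carrier)

  ZeroConstantTerm : Carrier R⟦t⟧ → Set ℓ
  ZeroConstantTerm u = u 0 ≈ᴿ 0ᴿ

  OnlyNonnegativePowersOfx : Carrier R⦅x⦆⦅t⦆ → Set ℓ
  OnlyNonnegativePowersOfx f =
    ∀ n m → m ℤ.< + 0 → Rx.coeff (Rxt-ls.coeff f n) m ≈ᴿ 0ᴿ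

  x : Carrier R⦅x⦆⦅t⦆
  x = Rxt-ls.const (Rx.monomial (+ 1) R.1#)

  PTₓ : Carrier R⦅x⦆⦅t⦆ → Carrier R⦅x⦆⦅t⦆
  PTₓ = mapCoeffs (Rx.fromPowerSeries ∘ Rx.nonnegative)

  CTₓ : Carrier R⦅x⦆⦅t⦆ → Carrier R⦅t⦆
  CTₓ = mapCoeffs (λ a → Rx.coeff a (+ 0))

  -- 1/(x − u) = Σ_{k ≥ 0} uᵏ x⁻¹⁻ᵏ.  The k-th term is divisible by tᵏ because
  -- u has no constant term.
  1/[x-_] : Carrier R⟦t⟧ → Carrier R⦅x⦆⦅t⦆
  1/[x- u ] = Rxt-ls.fromPowerSeries
    (PowerSeriesOps.Σ∞ R⦅x⦆ λ k l → Rx.monomial -[1+ k ] ((u Rt.^ k) l))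

  -- p(u₁,…,uₙ) for a power series p in z₁,…,zₙ, by
  -- p(u₁,…,uₙ) = Σ_{k ≥ 0} u₁ᵏ pₖ(u₂,…,uₙ), where p = Σ_{k ≥ 0} pₖ z₁ᵏ.
  eval : ∀ n → Carrier (R⟦z⟧ n) → Vector (Carrier R⟦t⟧) n → Carrier R⟦t⟧
  eval zero    p u = Rt-ps.C p
  eval (suc n) p u = Rt-ps.Σ∞ λ k →
    (Vector.head u Rt.^ k) Rt.* eval n (p k) (Vector.tail u)

  -- The same substitution z ↦ u for series with coefficients Laurent in t.
  substitute : ∀ n → Carrier (R⟦z⟧⦅t⦆ n) → Vector (Carrier R⟦t⟧) n → Carrier R⦅t⦆
  substitute n f u = order f ⟨ Rt-ps.Σ∞ (λ i →
    (Rt-ps.X Rt.^ i) Rt.* eval n (coeffs f i) u) ⟩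

  -- f(u), for f with only nonnegative powers of x (others are discarded).
  _⟨x≔_⟩ : Carrier R⦅x⦆⦅t⦆ → Carrier R⟦t⟧ → Carrier R⦅t⦆
  f ⟨x≔ u ⟩ = substitute 1 (mapCoeffs Rx.nonnegative f) (λ _ → u)

  R⦅t⦆→R⦅x⦆⦅t⦆ : Carrier R⦅t⦆ → Carrier R⦅x⦆⦅t⦆
  R⦅t⦆→R⦅x⦆⦅t⦆ = mapCoeffs Rx.const

  -- ∂ᵤ f = (f(x) − f(u)) / (x − u).  Division by x − u, an invertible element
  -- of R((x))((t)), is multiplication by 1/[x- u ].
  ∂ : Carrier R⟦t⟧ → Carrier R⦅x⦆⦅t⦆ → Carrier R⦅x⦆⦅t⦆
  ∂ u f = (f Rxt.+ (Rxt.- R⦅t⦆→R⦅x⦆⦅t⦆ (f ⟨x≔ u ⟩))) Rxt.* 1/[x- u ]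

  -- ∂_{uₙ} ⋯ ∂_{u₁} f: the first entry of u acts first.
  ∂s : ∀ {n} → Vector (Carrier R⟦t⟧) n → Carrier R⦅x⦆⦅t⦆ → Carrier R⦅x⦆⦅t⦆
  ∂s u f = Vector.foldl (λ g v → ∂ v g) f u

  Π1/[x-_] : ∀ {n} → Vector (Carrier R⟦t⟧) n → Carrier R⦅x⦆⦅t⦆
  Π1/[x- u ] = Rxt.product (λ i → 1/[x- u i ])

  constant : ∀ n → Carrier rawRing → Carrier (R⟦z⟧ n)
  constant zero    a = a
  constant (suc n) a = PowerSeriesOps.C (R⟦z⟧ n) (constant n a)

  -- p(zᵢ) for a power series p in one variable.
  atVariable : ∀ n → Fin n → Carrier (PowerSeries rawRing) → Carrier (R⟦z⟧ n)
  atVariable (suc n) zero    p = λ k → constant n (p k)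
  atVariable (suc n) (suc i) p = PowerSeriesOps.C (R⟦z⟧ n) (atVariable n i p)

  z : ∀ n → Vector (Carrier (R⟦z⟧ n)) n
  z n i = atVariable n i (PowerSeriesOps.X rawRing)

  -- f(zᵢ,t), for f with only nonnegative powers of x (others are discarded).
  at-z : ∀ n → Carrier R⦅x⦆⦅t⦆ → Vector (Carrier (R⟦z⟧⦅t⦆ n)) n
  at-z n f i = mapCoeffs (atVariable n i ∘ Rx.nonnegative) f

  -- Π_{j ≠ i} (zᵢ − zⱼ), as an element of R[[z₁,…,zₙ₊₁]]((t)).
  Πz-z : ∀ n → Vector (Carrier (R⟦z⟧⦅t⦆ (suc n))) (suc n)
  Πz-z n i = LaurentOps.const (R⟦z⟧ (suc n))
    (product (λ j → z (suc n) i + (- removeAt (z (suc n)) i j)))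
    where open Ops (R⟦z⟧ (suc n))

  -- P = Σᵢ Q(zᵢ,t) Π_{j ≠ i} (zᵢ − zⱼ)⁻¹, in the n + 1 variables z₁,…,zₙ₊₁.
  -- The differences zᵢ − zⱼ are not zero divisors, so there is at most one such P.
  IsPartialFractionSum : ∀ n → Carrier R⦅x⦆⦅t⦆ → Carrier (R⟦z⟧⦅t⦆ (suc n)) → Set ℓ
  IsPartialFractionSum n Q P = P IsSumOfFractions at-z (suc n) Q / Πz-z n
    where open Fractions (R⟦z⟧⦅t⦆ (suc n))

module Submission where

-- Write f/(x − u) = ∂ᵤf + f(u)/(x − u).  The coefficients of x^{−1−a} in f/(x − u)
-- and in f(u)/(x − u) are both f(u) uᵃ, so ∂ᵤf has no negative powers of x, while
-- f(u) Π 1/(x − uᵢ) has only negative ones.  Hence PTₓ f Π 1/(x − uᵢ) does not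
-- change when the first factor is dropped and f is replaced by ∂_{u₁}f.
-- For the constant term, expanding the product gives Σₘ qₘ h_{m−n}(u₁,…,uₙ₊₁)
-- when Q = Σₘ qₘ xᵐ, and Σₘ qₘ h_{m−n}(z₁,…,zₙ₊₁) is the divided difference of Q
-- at the zᵢ.  That it is also the sum of fractions is proved without fractions,
-- using only that the zᵢ − zⱼ are not zero divisors.

open import Defs
open import Algebra.Bundles using (CommutativeRing)
open import Algebra.Bundles.Raw using (RawRing)
open import Algebra.Structures using (IsCommutativeRing)
import Algebra.Properties.CommutativeMonoid.Sum as CommutativeMonoidSum
import Algebra.Properties.Ring as RingProperties
import Algebra.Properties.Semiring.Sum as SemiringSum
open import Data.Fin.Base using (zero; suc; toℕ; punchIn)
open import Data.Fin.Properties using (toℕ≤pred[n]; punchIn-injective; punchInᵢ≢i)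
open import Data.Integer.Base as ℤ using (ℤ; +_; -[1+_])
import Data.Integer.Properties as ℤ
open import Data.Integer.Tactic.RingSolver using (solve-∀)
open import Data.Nat.Base as ℕ using (ℕ; zero; suc; _∸_; z≤n; s≤s)
import Data.Nat.Properties as ℕ
open import Data.Product using (Σ-syntax; ∃; ∃!; _×_; _,_; proj₁; proj₂)
open import Data.Vec.Functional as Vector using (Vector; removeAt; tail)
open import Function.Base using (_∘_)
open import Level using (_⊔_; Lift; lift; lower)
open import Relation.Binary.PropositionalEquality as ≡ using (_≡_; _≢_)
import Relation.Binary.Reasoning.Setoid as SetoidReasoning
open import Relation.Nullary.Negation using (contradiction)

-- The points uᵢ may coincide and R may have zero divisors, so no uᵢ - uⱼ can be divided by, and the
-- right-hand side of the second formula cannot be computed at the uᵢ themselves. Both of its sides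
-- are therefore brought to Σₘ qₘ hₘ₋ₙ, which is meaningful at every u. The index m - n is a count
-- of degrees: n + 1 factors contribute x^(-n-1-k) hₖ and the extra x contributes 1, so the constant
-- term picks k = m - n. In the indeterminates zᵢ, write dᵢ for the product of the zᵢ - zⱼ. The
-- quotients D/dᵢ are replaced by weights wᵢ with dᵢ wᵢ = D for a common D. Keeping D and w
-- arbitrary lets an induction on the number of points pass from wᵢ to (zᵢ - zₚ) wᵢ without changing
-- D. The identity Σ 1/dᵢ = 0, for two or more points, becomes Σ wᵢ = 0. All infinite sums are
-- handled one power of t at a time. As uᵏ is divisible by tᵏ, each is finite there, and its range
-- may be enlarged to a common bound before sums are interchanged.

IsCommutativeRawRing : ∀ {c ℓ} → RawRing c ℓ → Set (c ⊔ ℓ)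
IsCommutativeRawRing A = IsCommutativeRing _≈_ _+_ _*_ -_ 0# 1#
  where open RawRing A

commutativeRing : ∀ {c ℓ} (A : RawRing c ℓ) → IsCommutativeRawRing A → CommutativeRing c ℓ
commutativeRing A isCR = record { isCommutativeRing = isCR }

-- Commutative rings and finite sums

module RawRingProperties {c ℓ} (A : RawRing c ℓ) (isCR : IsCommutativeRawRing A) where
  open CommutativeRing (commutativeRing A isCR) public hiding (rawRing; zero)
  open Ops A public using (sum; product; _^_; Σ[0⋯_]; cauchy; single)
  open SemiringSum semiring public
    using (sum-cong-≋; ∑-distrib-+; ∑-comm; *-distribˡ-sum; *-distribʳ-sum; sum-replicate-zero)
  open RingProperties ring public
    using (-0#≈0#; -‿distribˡ-*; -‿distribʳ-*; -‿involutive; -‿+-comm; x[y-z]≈xy-xz; [y-z]x≈yx-zx)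
  module Reasoning = SetoidReasoning setoid

  x-0≈x : ∀ x → x - 0# ≈ x
  x-0≈x x = trans (+-congˡ -0#≈0#) (+-identityʳ x)

  x-y+y≈x : ∀ x y → (x - y) + y ≈ x
  x-y+y≈x x y = trans (+-assoc _ _ _) (trans (+-congˡ (-‿inverseˡ y)) (+-identityʳ x))

  -- With x = f, y = f(u₁), v = 1/(x - u₁) and w the remaining factors, this is the splitting of f Π
  -- 1/(x - uᵢ) that drives the first formula.
  *-split : ∀ x y v w → x * (v * w) ≈ ((x - y) * v) * w + y * (v * w)
  *-split x y v w = begin
    x * (v * w)                        ≈⟨ *-congʳ (x-y+y≈x x y) ⟨
    ((x - y) + y) * (v * w)            ≈⟨ distribʳ (v * w) (x - y) y ⟩
    (x - y) * (v * w) + y * (v * w)    ≈⟨ +-congʳ (*-assoc (x - y) v w) ⟨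
    ((x - y) * v) * w + y * (v * w)    ∎
    where open Reasoning

  Σ-cong-≤ : ∀ n {f g : ℕ → Carrier} → (∀ k → k ℕ.≤ n → f k ≈ g k) → Σ[0⋯ n ] f ≈ Σ[0⋯ n ] g
  Σ-cong-≤ n f≈g = sum-cong-≋ {suc n} (λ i → f≈g (toℕ i) (toℕ≤pred[n] i))

  Σ-cong : ∀ n {f g : ℕ → Carrier} → (∀ k → f k ≈ g k) → Σ[0⋯ n ] f ≈ Σ[0⋯ n ] g
  Σ-cong n f≈g = Σ-cong-≤ n (λ k _ → f≈g k)

  Σ-zero : ∀ n {f : ℕ → Carrier} → (∀ k → f k ≈ 0#) → Σ[0⋯ n ] f ≈ 0#
  Σ-zero n f≈0 = trans (Σ-cong n f≈0) (sum-replicate-zero (suc n))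

  Σ-+ : ∀ n (f g : ℕ → Carrier) → Σ[0⋯ n ] (λ k → f k + g k) ≈ Σ[0⋯ n ] f + Σ[0⋯ n ] g
  Σ-+ n f g = ∑-distrib-+ {suc n} (f ∘ toℕ) (g ∘ toℕ)

  Σ-*ˡ : ∀ n x (f : ℕ → Carrier) → x * Σ[0⋯ n ] f ≈ Σ[0⋯ n ] (λ k → x * f k)
  Σ-*ˡ n x f = *-distribˡ-sum {suc n} x (f ∘ toℕ)

  Σ-*ʳ : ∀ n x (f : ℕ → Carrier) → Σ[0⋯ n ] f * x ≈ Σ[0⋯ n ] (λ k → f k * x)
  Σ-*ʳ n x f = *-distribʳ-sum {suc n} x (f ∘ toℕ)

  Σ-swap : ∀ m n (f : ℕ → ℕ → Carrier) →
           Σ[0⋯ m ] (λ i → Σ[0⋯ n ] (f i)) ≈ Σ[0⋯ n ] (λ j → Σ[0⋯ m ] (λ i → f i j))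
  Σ-swap m n f = ∑-comm {suc m} {suc n} (λ i j → f (toℕ i) (toℕ j))

  -- Gives sums whose natural ranges differ a common upper bound, so that they can be interchanged
  -- or shifted.
  Σ-truncate : ∀ {i j} (f : ℕ → Carrier) → i ℕ.≤ j → (∀ k → i ℕ.< k → f k ≈ 0#) →
               Σ[0⋯ j ] f ≈ Σ[0⋯ i ] f
  Σ-truncate {j = zero}  f z≤n f≈0 = refl
  Σ-truncate {j = suc j} f z≤n f≈0 = +-congˡ (Σ-zero j (λ k → f≈0 (suc k) (s≤s z≤n)))
  Σ-truncate f (s≤s i≤j) f≈0 = +-congˡ (Σ-truncate (f ∘ suc) i≤j (λ k i<k → f≈0 (suc k) (s≤s i<k)))

-- Power series

module PowerSeriesProperties {c ℓ} (A : RawRing c ℓ) (isCR : IsCommutativeRawRing A) where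
  open RawRingProperties A isCR

  infix 4 _≋_
  _≋_ : (ℕ → Carrier) → (ℕ → Carrier) → Set ℓ
  f ≋ g = ∀ k → f k ≈ g k

  cauchy-cong : ∀ {f f′ g g′} → f ≋ f′ → g ≋ g′ → cauchy f g ≋ cauchy f′ g′
  cauchy-cong f≋f′ g≋g′ k = Σ-cong k (λ i → *-cong (f≋f′ i) (g≋g′ (k ∸ i)))

  cauchy-zeroˡ : ∀ {f} g → (∀ k → f k ≈ 0#) → ∀ k → cauchy f g k ≈ 0#
  cauchy-zeroˡ g f≈0 k = Σ-zero k (λ i → trans (*-congʳ (f≈0 i)) (zeroˡ (g (k ∸ i))))

  cauchy-scaleˡ : ∀ a f g → cauchy (λ k → a * f k) g ≋ (λ k → a * cauchy f g k)
  cauchy-scaleˡ a f g k = trans (Σ-cong k (λ i → *-assoc a (f i) (g (k ∸ i)))) (sym (Σ-*ˡ k a (λ i → f i * g (k ∸ i))))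

  cauchy-distribʳ : ∀ f g h → cauchy (λ k → f k + g k) h ≋ (λ k → cauchy f h k + cauchy g h k)
  cauchy-distribʳ f g h k = trans (Σ-cong k (λ i → distribʳ (h (k ∸ i)) (f i) (g i)))
                                  (Σ-+ k (λ i → f i * h (k ∸ i)) (λ i → g i * h (k ∸ i)))

  -- `cauchy` unfolds at the lowest coefficient of its first factor; commutativity also needs the
  -- opposite end split off.
  cauchy-last : ∀ k f g → cauchy f g (suc k) ≈ cauchy f (g ∘ suc) k + f (suc k) * g 0
  cauchy-last zero f g = begin
    f 0 * g 1 + (f 1 * g 0 + 0#)  ≈⟨ +-congˡ (+-identityʳ _) ⟩
    f 0 * g 1 + f 1 * g 0         ≈⟨ +-congʳ (+-identityʳ _) ⟨
    (f 0 * g 1 + 0#) + f 1 * g 0  ∎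
    where open Reasoning
  cauchy-last (suc k) f g =
    trans (+-congˡ (cauchy-last k (f ∘ suc) g)) (sym (+-assoc _ _ _))

  cauchy-comm : ∀ f g → cauchy f g ≋ cauchy g f
  cauchy-comm f g zero = +-congʳ (*-comm _ _)
  cauchy-comm f g (suc k) = begin
    f 0 * g (suc k) + cauchy (f ∘ suc) g k  ≈⟨ +-cong (*-comm _ _) (cauchy-comm (f ∘ suc) g k) ⟩
    g (suc k) * f 0 + cauchy g (f ∘ suc) k  ≈⟨ +-comm _ _ ⟩
    cauchy g (f ∘ suc) k + g (suc k) * f 0  ≈⟨ cauchy-last k g f ⟨
    cauchy g f (suc k)                      ∎
    where open Reasoning

  -- Writing f = f 0 + X · (f ∘ suc), both sides are additive in f: the constant part is a scaling,
  -- and the shifted part is the induction hypothesis one degree lower.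
  cauchy-assoc : ∀ f g h → cauchy (cauchy f g) h ≋ cauchy f (cauchy g h)
  cauchy-assoc f g h zero = begin
    (f 0 * g 0 + 0#) * h 0 + 0#  ≈⟨ +-congʳ (*-congʳ (+-identityʳ _)) ⟩
    f 0 * g 0 * h 0 + 0#         ≈⟨ +-congʳ (*-assoc _ _ _) ⟩
    f 0 * (g 0 * h 0) + 0#       ≈⟨ +-congʳ (*-congˡ (+-identityʳ _)) ⟨
    f 0 * (g 0 * h 0 + 0#) + 0#  ∎
    where open Reasoning
  cauchy-assoc f g h (suc k) = begin
    (f 0 * g 0 + 0#) * h (suc k)
      + cauchy (λ j → f 0 * g (suc j) + cauchy (f ∘ suc) g j) h k
      ≈⟨ +-cong (trans (*-congʳ (+-identityʳ _)) (*-assoc _ _ _))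
                (cauchy-distribʳ (λ j → f 0 * g (suc j)) (cauchy (f ∘ suc) g) h k) ⟩
    f 0 * (g 0 * h (suc k))
      + (cauchy (λ j → f 0 * g (suc j)) h k + cauchy (cauchy (f ∘ suc) g) h k)
      ≈⟨ +-congˡ (+-cong (cauchy-scaleˡ (f 0) (g ∘ suc) h k) (cauchy-assoc (f ∘ suc) g h k)) ⟩
    f 0 * (g 0 * h (suc k)) + (f 0 * cauchy (g ∘ suc) h k + cauchy (f ∘ suc) (cauchy g h) k)
      ≈⟨ +-assoc _ _ _ ⟨
    (f 0 * (g 0 * h (suc k)) + f 0 * cauchy (g ∘ suc) h k) + cauchy (f ∘ suc) (cauchy g h) k
      ≈⟨ +-congʳ (distribˡ _ _ _) ⟨
    f 0 * (g 0 * h (suc k) + cauchy (g ∘ suc) h k) + cauchy (f ∘ suc) (cauchy g h) k  ∎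
    where open Reasoning

  cauchy-single : ∀ a f → cauchy (single a) f ≋ (λ k → a * f k)
  cauchy-single a f zero    = +-identityʳ _
  cauchy-single a f (suc k) = trans (+-congˡ (cauchy-zeroˡ f (λ _ → refl) k)) (+-identityʳ _)

  single-cong : ∀ {a b} → a ≈ b → single a ≋ single b
  single-cong a≈b zero    = a≈b
  single-cong a≈b (suc k) = refl

  single-zero : ∀ {a} → a ≈ 0# → ∀ k → single a k ≈ 0#
  single-zero a≈0 zero    = a≈0
  single-zero a≈0 (suc k) = refl

  cauchy-identityˡ : ∀ f → cauchy (single 1#) f ≋ f
  cauchy-identityˡ f k = trans (cauchy-single 1# f k) (*-identityˡ _)

  powerSeries-isCR : IsCommutativeRawRing (PowerSeries A)
  powerSeries-isCR = record
    { isRing = record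
      { +-isAbelianGroup = record
        { isGroup = record
          { isMonoid = record
            { isSemigroup = record
              { isMagma = record
                { isEquivalence = record
                  { refl  = λ k → refl
                  ; sym   = λ p k → sym (p k)
                  ; trans = λ p q k → trans (p k) (q k)
                  }
                ; ∙-cong = λ p q k → +-cong (p k) (q k)
                }
              ; assoc = λ f g h k → +-assoc _ _ _
              }
            ; identity = (λ f k → +-identityˡ _) , (λ f k → +-identityʳ _)
            }
          ; inverse = (λ f k → -‿inverseˡ _) , (λ f k → -‿inverseʳ _)
          ; ⁻¹-cong = λ p k → -‿cong (p k)
          }
        ; comm = λ f g k → +-comm _ _
        }
      ; *-cong = cauchy-cong
      ; *-assoc = cauchy-assoc
      ; *-identity = cauchy-identityˡ
                   , (λ f k → trans (cauchy-comm f (single 1#) k) (cauchy-identityˡ f k))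
      ; distrib = (λ f g h k → trans (cauchy-comm f (λ j → g j + h j) k)
                               (trans (cauchy-distribʳ g h f k)
                               (+-cong (cauchy-comm g f k) (cauchy-comm h f k))))
                , (λ f g h → cauchy-distribʳ g h f)
      }
    ; *-comm = cauchy-comm
    }

  single-* : ∀ a b → cauchy (single a) (single b) ≋ single (a * b)
  single-* a b zero    = cauchy-single a (single b) zero
  single-* a b (suc k) = trans (cauchy-single a (single b) (suc k)) (zeroʳ a)

  single-- : ∀ a b k → single a k - single b k ≈ single (a - b) k
  single-- a b zero    = refl
  single-- a b (suc k) = -‿inverseʳ 0#

  private module X = PowerSeriesOps A

  cauchy-X-zero : ∀ f → cauchy X.X f 0 ≈ 0#
  cauchy-X-zero f = trans (+-identityʳ _) (zeroˡ _)

  cauchy-X-suc : ∀ f k → cauchy X.X f (suc k) ≈ f k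
  cauchy-X-suc f k = trans (+-cong (zeroˡ _) (cauchy-identityˡ f k)) (+-identityˡ _)

-- Laurent series

module LaurentProperties {c ℓ} (A : RawRing c ℓ) (isCR : IsCommutativeRawRing A) where
  open RawRingProperties A isCR
  open PowerSeriesProperties A isCR
  open LaurentOps A
  private module L = RawRing (Laurent A)

  -- Separates the exponent difference from the case distinction in `coeff`, so that integer
  -- identities can be applied to it by congruence.
  extend : (ℕ → Carrier) → ℤ → Carrier
  extend f (+ k)    = f k
  extend f -[1+ k ] = 0#

  coeff≡extend : ∀ f m → coeff f m ≡ extend (coeffs f) (m ℤ.- order f)
  coeff≡extend f m with m ℤ.- order f
  ... | + k      = ≡.refl
  ... | -[1+ _ ] = ≡.refl

  coeff-at : ∀ o F k → coeff (o ⟨ F ⟩) (o ℤ.+ + k) ≡ F k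
  coeff-at o F k = ≡.trans (coeff≡extend (o ⟨ F ⟩) (o ℤ.+ + k)) (≡.cong (extend F) (lemma o (+ k)))
    where
    lemma : ∀ o k → (o ℤ.+ k) ℤ.- o ≡ k
    lemma = solve-∀

  data Position (o m : ℤ) : Set where
    above : ∀ k → m ≡ o ℤ.+ + k → Position o m
    below : m ℤ.< o → Position o m

  position : ∀ o m → Position o m
  position o m with m ℤ.- o in eq
  ... | + k      = above k (≡.trans (lemma o m) (≡.cong (λ j → o ℤ.+ j) eq))
    where
    lemma : ∀ o m → m ≡ o ℤ.+ (m ℤ.- o)
    lemma = solve-∀
  ... | -[1+ k ] = below (≡.subst₂ ℤ._<_ (lemma o m) (ℤ.+-identityˡ o)
                     (ℤ.+-monoˡ-< o (≡.subst (ℤ._< + 0) (≡.sym eq) ℤ.-<+)))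
    where
    lemma : ∀ o m → (m ℤ.- o) ℤ.+ o ≡ m
    lemma = solve-∀

  coeff-below : ∀ f {m} → m ℤ.< order f → coeff f m ≈ 0#
  coeff-below f {m} m<o with m ℤ.- order f in eq
  ... | + k      with () ← ℤ.<⇒≱ (≡.subst₂ ℤ._<_ eq (ℤ.+-inverseʳ (order f))
                                    (ℤ.+-monoˡ-< (ℤ.- order f) m<o)) (ℤ.+≤+ z≤n)
  ... | -[1+ _ ] = refl

  ≈-from : ∀ {f g} o → o ℤ.≤ order f → o ℤ.≤ order g →
           (∀ k → coeff f (o ℤ.+ + k) ≈ coeff g (o ℤ.+ + k)) → f L.≈ g
  ≈-from {f} {g} o o≤f o≤g f≈g m with position o m
  ... | above k ≡.refl = f≈g k
  ... | below m<o = trans (coeff-below f (ℤ.<-≤-trans m<o o≤f)) (sym (coeff-below g (ℤ.<-≤-trans m<o o≤g)))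

  ⟨⟩-cong : ∀ {o o′ F G} → o ≡ o′ → F ≋ G → (o ⟨ F ⟩) L.≈ (o′ ⟨ G ⟩)
  ⟨⟩-cong {o} {F = F} {G} ≡.refl F≋G = ≈-from o ℤ.≤-refl ℤ.≤-refl λ k →
    trans (reflexive (coeff-at o F k)) (trans (F≋G k) (sym (reflexive (coeff-at o G k))))

  ⟨⟩-injective : ∀ {o F G} → (o ⟨ F ⟩) L.≈ (o ⟨ G ⟩) → F ≋ G
  ⟨⟩-injective {o} {F} {G} eq k =
    trans (sym (reflexive (coeff-at o F k))) (trans (eq (o ℤ.+ + k)) (reflexive (coeff-at o G k)))

  -- Multiplication by the e-th power of the variable, on coefficient sequences. It compensates for
  -- lowering the order by e.
  pad : ℕ → (ℕ → Carrier) → ℕ → Carrier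
  pad zero    F k       = F k
  pad (suc e) F zero    = 0#
  pad (suc e) F (suc k) = pad e F k

  pad-1 : ∀ o F e → (o ⟨ pad (suc e) F ⟩) L.≈ ((o ℤ.+ + 1) ⟨ pad e F ⟩)
  pad-1 o F e m = begin
    coeff (o ⟨ pad (suc e) F ⟩) m               ≡⟨ coeff≡extend (o ⟨ pad (suc e) F ⟩) m ⟩
    extend (pad (suc e) F) (m ℤ.- o)            ≈⟨ extend-pad (m ℤ.- o) ⟩
    extend (pad e F) ((m ℤ.- o) ℤ.- + 1)        ≡⟨ ≡.cong (extend (pad e F)) (lemma m o (+ 1)) ⟩
    extend (pad e F) (m ℤ.- (o ℤ.+ + 1))        ≡⟨ coeff≡extend ((o ℤ.+ + 1) ⟨ pad e F ⟩) m ⟨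
    coeff ((o ℤ.+ + 1) ⟨ pad e F ⟩) m           ∎
    where
    open Reasoning
    lemma : ∀ m o i → (m ℤ.- o) ℤ.- i ≡ m ℤ.- (o ℤ.+ i)
    lemma = solve-∀
    extend-pad : ∀ j → extend (pad (suc e) F) j ≈ extend (pad e F) (j ℤ.- + 1)
    extend-pad (+ zero)  = refl
    extend-pad (+ suc k) = refl
    extend-pad -[1+ k ]  = refl

  pad-≈ : ∀ e o F → (o ⟨ pad e F ⟩) L.≈ ((o ℤ.+ + e) ⟨ F ⟩)
  pad-≈ zero    o F m = ⟨⟩-cong (≡.sym (ℤ.+-identityʳ o)) (λ _ → refl) m
  pad-≈ (suc e) o F m = trans (pad-1 o F e m) (trans (pad-≈ e (o ℤ.+ + 1) F m)
                          (⟨⟩-cong (ℤ.+-assoc o (+ 1) (+ e)) (λ _ → refl) m))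

  cauchy-pad : ∀ e F G → cauchy (pad e F) G ≋ pad e (cauchy F G)
  cauchy-pad zero    F G k       = refl
  cauchy-pad (suc e) F G zero    = trans (+-identityʳ _) (zeroˡ _)
  cauchy-pad (suc e) F G (suc k) = trans (+-cong (zeroˡ _) (cauchy-pad e F G k)) (+-identityˡ _)

  offset : ∀ {o o′} → o ℤ.≤ o′ → ∃ λ e → o′ ≡ o ℤ.+ + e
  offset {o} {o′} o≤o′ with position o o′
  ... | above e eq = e , eq
  ... | below o′<o with () ← ℤ.<⇒≱ o′<o o≤o′

  *-pad : ∀ {f g o e} → order f ≡ o ℤ.+ + e → (f L.* g) L.≈ ((o ⟨ pad e (coeffs f) ⟩) L.* g)
  *-pad {f} {g} {o} {e} ≡.refl m =
    trans (⟨⟩-cong {F = cauchy (coeffs f) (coeffs g)} (lemma o (+ e) (order g)) (λ _ → refl) m)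
    (trans (sym (pad-≈ e (o ℤ.+ order g) (cauchy (coeffs f) (coeffs g)) m))
           (⟨⟩-cong {o = o ℤ.+ order g} ≡.refl (λ k → sym (cauchy-pad e (coeffs f) (coeffs g) k)) m))
    where
    lemma : ∀ a b c → a ℤ.+ b ℤ.+ c ≡ a ℤ.+ c ℤ.+ b
    lemma = solve-∀

  expand : ∀ o f e → order f ≡ o ℤ.+ + e → f L.≈ (o ⟨ pad e (coeffs f) ⟩)
  expand o f e ≡.refl m = sym (pad-≈ e o (coeffs f) m)

  -- The product is defined on representations, and equal series may have different orders. Padding
  -- both down to the smaller order makes them equal coefficient by coefficient, and padding
  -- commutes with `cauchy`.
  *-congʳ-laurent : ∀ {f f′ g} → f L.≈ f′ → (f L.* g) L.≈ (f′ L.* g)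
  *-congʳ-laurent {f} {f′} {g} f≈f′ m
    with e , p ← offset (ℤ.i⊓j≤i (order f) (order f′))
       | e′ , p′ ← offset (ℤ.i⊓j≤j (order f) (order f′)) = begin
    coeff (f L.* g) m                          ≈⟨ *-pad {f} {g} {o} {e} p m ⟩
    coeff ((o ⟨ pad e (coeffs f) ⟩) L.* g) m
      ≈⟨ ⟨⟩-cong {o ℤ.+ order g} ≡.refl (cauchy-cong {g = coeffs g} padded (λ _ → refl)) m ⟩
    coeff ((o ⟨ pad e′ (coeffs f′) ⟩) L.* g) m  ≈⟨ *-pad {f′} {g} {o} {e′} p′ m ⟨
    coeff (f′ L.* g) m  ∎
    where
    open Reasoning
    o = order f ℤ.⊓ order f′
    padded : pad e (coeffs f) ≋ pad e′ (coeffs f′)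
    padded = ⟨⟩-injective {o} {pad e (coeffs f)} {pad e′ (coeffs f′)} λ n →
      trans (sym (expand o f e p n)) (trans (f≈f′ n) (expand o f′ e′ p′ n))

  *-comm-laurent : ∀ f g → (f L.* g) L.≈ (g L.* f)
  *-comm-laurent f g = ⟨⟩-cong (ℤ.+-comm (order f) (order g)) (cauchy-comm (coeffs f) (coeffs g))

  *-congˡ-laurent : ∀ {f g g′} → g L.≈ g′ → (f L.* g) L.≈ (f L.* g′)
  *-congˡ-laurent {f} {g} {g′} g≈g′ m =
    trans (*-comm-laurent f g m) (trans (*-congʳ-laurent {g} {g′} {f} g≈g′ m) (*-comm-laurent g′ f m))

  coeff-+ : ∀ f g m → coeff (f L.+ g) m ≈ coeff f m + coeff g m
  coeff-+ f g m with position (order f ℤ.⊓ order g) m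
  ... | above k ≡.refl = reflexive (coeff-at (order f ℤ.⊓ order g) _ k)
  ... | below m<o = trans (coeff-below (f L.+ g) m<o) (sym (trans
          (+-cong (coeff-below f (ℤ.<-≤-trans m<o (ℤ.i⊓j≤i (order f) (order g))))
                  (coeff-below g (ℤ.<-≤-trans m<o (ℤ.i⊓j≤j (order f) (order g)))))
          (+-identityʳ 0#)))

  coeff-neg : ∀ f m → coeff (L.- f) m ≈ - coeff f m
  coeff-neg f m with m ℤ.- order f
  ... | + k      = refl
  ... | -[1+ _ ] = sym -0#≈0#

  coeff-monomial-zero : ∀ {a} o → a ≈ 0# → ∀ m → coeff (monomial o a) m ≈ 0#
  coeff-monomial-zero o a≈0 m with m ℤ.- o
  ... | + k      = single-zero a≈0 k
  ... | -[1+ _ ] = refl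

  coeff-0 : ∀ m → coeff L.0# m ≈ 0#
  coeff-0 = coeff-monomial-zero (+ 0) refl

  rebase : ∀ {f o} → o ℤ.≤ order f → f L.≈ (o ⟨ (λ k → coeff f (o ℤ.+ + k)) ⟩)
  rebase {f} {o} o≤f = ≈-from o o≤f ℤ.≤-refl λ k → sym (reflexive (coeff-at o _ k))

  +-sameOrder : ∀ o F G → ((o ⟨ F ⟩) L.+ (o ⟨ G ⟩)) L.≈ (o ⟨ (λ k → F k + G k) ⟩)
  +-sameOrder o F G m with position o m
  ... | above k ≡.refl = trans (coeff-+ (o ⟨ F ⟩) (o ⟨ G ⟩) m) (trans
      (+-cong (reflexive (coeff-at o F k)) (reflexive (coeff-at o G k)))
      (sym (reflexive (coeff-at o _ k))))
  ... | below m<o = trans (coeff-+ (o ⟨ F ⟩) (o ⟨ G ⟩) m) (trans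
      (+-cong (coeff-below (o ⟨ F ⟩) m<o) (coeff-below (o ⟨ G ⟩) m<o))
      (trans (+-identityʳ 0#) (sym (coeff-below (o ⟨ _ ⟩) m<o))))

  -- The sum is already written at the minimum o of the two orders. Each summand is rewritten at o
  -- as well, where distributivity is that of `cauchy`.
  *-distribʳ-laurent : ∀ f g h → ((g L.+ h) L.* f) L.≈ ((g L.* f) L.+ (h L.* f))
  *-distribʳ-laurent f g h m = begin
    coeff ((g L.+ h) L.* f) m
      ≈⟨ ⟨⟩-cong ≡.refl (cauchy-distribʳ G H (coeffs f)) m ⟩
    coeff ((o ℤ.+ order f) ⟨ (λ k → cauchy G (coeffs f) k + cauchy H (coeffs f) k) ⟩) m
      ≈⟨ +-sameOrder (o ℤ.+ order f) _ _ m ⟨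
    coeff (((o ⟨ G ⟩) L.* f) L.+ ((o ⟨ H ⟩) L.* f)) m
      ≈⟨ coeff-+ ((o ⟨ G ⟩) L.* f) ((o ⟨ H ⟩) L.* f) m ⟩
    coeff ((o ⟨ G ⟩) L.* f) m + coeff ((o ⟨ H ⟩) L.* f) m
      ≈⟨ +-cong (*-congʳ-laurent {g} {o ⟨ G ⟩} {f} (rebase (ℤ.i⊓j≤i (order g) (order h))) m)
                (*-congʳ-laurent {h} {o ⟨ H ⟩} {f} (rebase (ℤ.i⊓j≤j (order g) (order h))) m) ⟨
    coeff (g L.* f) m + coeff (h L.* f) m
      ≈⟨ coeff-+ (g L.* f) (h L.* f) m ⟨
    coeff ((g L.* f) L.+ (h L.* f)) m  ∎
    where
    open Reasoning
    o = order g ℤ.⊓ order h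
    G H : ℕ → Carrier
    G k = coeff g (o ℤ.+ + k)
    H k = coeff h (o ℤ.+ + k)

  laurent-isCR : IsCommutativeRawRing (Laurent A)
  laurent-isCR = record
    { isRing = record
      { +-isAbelianGroup = record
        { isGroup = record
          { isMonoid = record
            { isSemigroup = record
              { isMagma = record
                { isEquivalence = record
                  { refl  = λ m → refl
                  ; sym   = λ p m → sym (p m)
                  ; trans = λ p q m → trans (p m) (q m)
                  }
                ; ∙-cong = λ {f} {f′} {g} {g′} p q m → trans (coeff-+ f g m)
                    (trans (+-cong (p m) (q m)) (sym (coeff-+ f′ g′ m)))
                }
              ; assoc = λ f g h m → trans (coeff-+ (f L.+ g) h m)
                  (trans (+-congʳ (coeff-+ f g m)) (trans (+-assoc _ _ _)
                  (sym (trans (coeff-+ f (g L.+ h) m) (+-congˡ (coeff-+ g h m))))))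
              }
            ; identity =
                (λ f m → trans (coeff-+ L.0# f m) (trans (+-congʳ (coeff-0 m)) (+-identityˡ _)))
              , (λ f m → trans (coeff-+ f L.0# m) (trans (+-congˡ (coeff-0 m)) (+-identityʳ _)))
            }
          ; inverse =
              (λ f m → trans (coeff-+ (L.- f) f m) (trans (+-congʳ (coeff-neg f m))
                         (trans (-‿inverseˡ _) (sym (coeff-0 m)))))
            , (λ f m → trans (coeff-+ f (L.- f) m) (trans (+-congˡ (coeff-neg f m))
                         (trans (-‿inverseʳ _) (sym (coeff-0 m)))))
          ; ⁻¹-cong = λ {f} {g} p m → trans (coeff-neg f m) (trans (-‿cong (p m)) (sym (coeff-neg g m)))
          }
        ; comm = λ f g m → trans (coeff-+ f g m) (trans (+-comm _ _) (sym (coeff-+ g f m)))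
        }
      ; *-cong = λ {f} {f′} {g} {g′} p q m →
          trans (*-congʳ-laurent {f} {f′} {g} p m) (*-congˡ-laurent {f′} {g} {g′} q m)
      ; *-assoc = λ f g h → ⟨⟩-cong (ℤ.+-assoc (order f) (order g) (order h))
                              (cauchy-assoc (coeffs f) (coeffs g) (coeffs h))
      ; *-identity = identityˡ
                   , (λ f m → trans (*-comm-laurent f L.1# m) (identityˡ f m))
      ; distrib = (λ f g h m → trans (*-comm-laurent f (g L.+ h) m) (trans (*-distribʳ-laurent f g h m)
                    (trans (coeff-+ (g L.* f) (h L.* f) m)
                    (trans (+-cong (*-comm-laurent g f m) (*-comm-laurent h f m))
                           (sym (coeff-+ (f L.* g) (f L.* h) m))))))
                , *-distribʳ-laurent
      }
    ; *-comm = *-comm-laurent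
    }
    where
    identityˡ : ∀ f → (L.1# L.* f) L.≈ f
    identityˡ f = ⟨⟩-cong (ℤ.+-identityˡ (order f)) (cauchy-identityˡ (coeffs f))

  coeff-scale : ∀ a o F m → coeff (o ⟨ (λ k → a * F k) ⟩) m ≈ a * coeff (o ⟨ F ⟩) m
  coeff-scale a o F m with m ℤ.- o
  ... | + k      = refl
  ... | -[1+ _ ] = sym (zeroʳ a)

  coeff-const-* : ∀ a f m → coeff (const a L.* f) m ≈ a * coeff f m
  coeff-const-* a f m = trans (⟨⟩-cong (ℤ.+-identityˡ (order f)) (cauchy-single a (coeffs f)) m)
                              (coeff-scale a (order f) (coeffs f) m)

  coeff-*-const : ∀ f a m → coeff (f L.* const a) m ≈ coeff f m * a
  coeff-*-const f a m = trans (*-comm-laurent f (const a) m) (trans (coeff-const-* a f m) (*-comm a _))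

  const-product : ∀ {n} (v : Vector Carrier n) → Ops.product (Laurent A) (const ∘ v) L.≈ const (product v)
  const-product {zero}  v m = refl
  const-product {suc n} v m =
    trans (*-congˡ-laurent {const (v zero)} (const-product (v ∘ suc)) m)
          (⟨⟩-cong {+ 0} ≡.refl (single-* (v zero) (product (v ∘ suc))) m)

  coeff-sum : ∀ {n} (v : Vector L.Carrier n) m → coeff (Ops.sum (Laurent A) v) m ≈ sum (λ i → coeff (v i) m)
  coeff-sum {zero}  v m = coeff-0 m
  coeff-sum {suc n} v m = trans (coeff-+ (v zero) _ m) (+-congˡ (coeff-sum (v ∘ suc) m))

-- Partial fractions

module PartialFractions {c ℓ} (A : RawRing c ℓ) (isCR : IsCommutativeRawRing A) where
  open RawRingProperties A isCR
  open CommutativeMonoidSum +-commutativeMonoid using (sum-remove)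
  open CommutativeMonoidSum *-commutativeMonoid using () renaming (sum-remove to product-remove)

  -- Over an arbitrary R being nonzero does not permit cancellation, so the differences of the
  -- points are required to be non-zero-divisors.
  Cancellable : Carrier → Set (c ⊔ ℓ)
  Cancellable d = ∀ a → d * a ≈ 0# → a ≈ 0#

  cancellable-resp-≈ : ∀ {d e} → d ≈ e → Cancellable d → Cancellable e
  cancellable-resp-≈ d≈e d-canc a ea≈0 = d-canc a (trans (*-congʳ d≈e) ea≈0)

  cancellable-neg : ∀ {d} → Cancellable d → Cancellable (- d)
  cancellable-neg {d} d-canc a -da≈0 = d-canc a (begin
    d * a          ≈⟨ -‿involutive _ ⟨
    - - (d * a)    ≈⟨ -‿cong (-‿distribˡ-* d a) ⟩
    - (- d * a)    ≈⟨ -‿cong -da≈0 ⟩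
    - 0#           ≈⟨ -0#≈0# ⟩
    0#             ∎)
    where open Reasoning

  cancellable-product : ∀ {n} (d : Vector Carrier n) → (∀ i → Cancellable (d i)) → Cancellable (product d)
  cancellable-product {zero}  d d-canc a 1a≈0 = trans (sym (*-identityˡ a)) 1a≈0
  cancellable-product {suc n} d d-canc a da≈0 =
    cancellable-product (tail d) (d-canc ∘ suc) a (d-canc zero _ (trans (sym (*-assoc _ _ _)) da≈0))

  cancel : ∀ {d} → Cancellable d → ∀ {a b} → d * a ≈ d * b → a ≈ b
  cancel {d} d-canc {a} {b} da≈db = begin
    a            ≈⟨ x-y+y≈x a b ⟨
    (a - b) + b  ≈⟨ +-congʳ (d-canc (a - b) d[a-b]≈0) ⟩
    0# + b       ≈⟨ +-identityˡ b ⟩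
    b            ∎
    where
    open Reasoning
    d[a-b]≈0 : d * (a - b) ≈ 0#
    d[a-b]≈0 = begin
      d * (a - b)        ≈⟨ distribˡ d a (- b) ⟩
      d * a + d * - b    ≈⟨ +-cong da≈db (sym (-‿distribʳ-* d b)) ⟩
      d * b - d * b      ≈⟨ -‿inverseʳ _ ⟩
      0#                 ∎

  Distinct : ∀ {n} → Vector Carrier n → Set (c ⊔ ℓ)
  Distinct z = ∀ {i j} → i ≢ j → Cancellable (z i - z j)

  distinct-removeAt : ∀ {n} {z : Vector Carrier (suc n)} p → Distinct z → Distinct (removeAt z p)
  distinct-removeAt p dist i≢j = dist (i≢j ∘ punchIn-injective p _ _)

  -- The denominators of the partial fractions: the derivative of Πⱼ (T - zⱼ) at T = zᵢ.
  gaps : ∀ {n} → Vector Carrier (suc n) → Vector Carrier (suc n)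
  gaps z i = product (λ j → z i - removeAt z i j)

  -- For the point z₀ the factor zᵢ - z₀ heads the product and splits off by computation; for z₁ it
  -- has to be moved past zᵢ - z₀.
  gaps-removeAt-1 : ∀ {n} (z : Vector Carrier (suc (suc n))) i → let p = suc zero in
                    gaps z (punchIn p i) ≈ gaps (removeAt z p) i * (removeAt z p i - z p)
  gaps-removeAt-1 z zero = *-comm _ _
  gaps-removeAt-1 {suc n} z (suc i) = trans (*-congˡ (*-comm _ _)) (sym (*-assoc _ _ _))

  telescope : ∀ x y z → (x - y) + (y - z) ≈ x - z
  telescope x y z = trans (sym (+-assoc _ _ _)) (+-congʳ (x-y+y≈x x y))

  -- If D = dᵢ wᵢ with dᵢ = Π_{j ≠ i} (zᵢ − zⱼ), then the numbers (zᵢ − zₚ) wᵢ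
  -- play the role of wᵢ for the same D and the points other than zₚ.
  -- As z₁ − z₀ = (zᵢ − z₀) − (zᵢ − z₁), induction applied to p = 0 and p = 1 kills
  -- (z₁ − z₀) Σᵢ wᵢ.
  Σweights≈0 : ∀ n (z w : Vector Carrier (suc (suc n))) D → Distinct z →
               (∀ i → gaps z i * w i ≈ D) → sum w ≈ 0#
  Σweights≈0 zero z w D dist dw≈D = dist {zero} {suc zero} (λ ()) _ (begin
    (x - y) * (w₀ + (w₁ + 0#))          ≈⟨ *-congˡ (+-congˡ (+-identityʳ w₁)) ⟩
    (x - y) * (w₀ + w₁)                 ≈⟨ distribˡ _ _ _ ⟩
    (x - y) * w₀ + (x - y) * w₁
      -- D equals both (x - y) w₀ and (y - x) w₁, so the two differences can be gathered on w₁,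
      -- where they cancel.
      ≈⟨ +-congʳ (trans (lemma x y w₀ (dw≈D zero)) (sym (lemma y x w₁ (dw≈D (suc zero))))) ⟩
    (y - x) * w₁ + (x - y) * w₁         ≈⟨ distribʳ _ _ _ ⟨
    ((y - x) + (x - y)) * w₁            ≈⟨ *-congʳ (telescope y x y) ⟩
    (y - y) * w₁                        ≈⟨ *-congʳ (-‿inverseʳ y) ⟩
    0# * w₁                             ≈⟨ zeroˡ w₁ ⟩
    0#                                  ∎)
    where
    open Reasoning
    x = z zero
    y = z (suc zero)
    w₀ = w zero
    w₁ = w (suc zero)
    lemma : ∀ a b v → ((a - b) * 1#) * v ≈ D → (a - b) * v ≈ D
    lemma a b v eq = trans (*-congʳ (sym (*-identityʳ _))) eq
  Σweights≈0 (suc n) z w D dist dw≈D = dist {suc zero} {zero} (λ ()) _ (begin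
    (y - x) * sum w                           ≈⟨ +-identityˡ _ ⟨
    0# + (y - x) * sum w                      ≈⟨ +-congʳ Σ[z-y]w≈0 ⟨
    sum (λ i → (z i - y) * w i) + (y - x) * sum w
      ≈⟨ +-congˡ (*-distribˡ-sum (y - x) w) ⟩
    sum (λ i → (z i - y) * w i) + sum (λ i → (y - x) * w i)
      ≈⟨ ∑-distrib-+ (λ i → (z i - y) * w i) (λ i → (y - x) * w i) ⟨
    sum (λ i → (z i - y) * w i + (y - x) * w i)
      ≈⟨ sum-cong-≋ (λ i → trans (sym (distribʳ (w i) _ _)) (*-congʳ (telescope (z i) y x))) ⟩
    sum (λ i → (z i - x) * w i)               ≈⟨ Σ[z-x]w≈0 ⟩
    0#                                        ∎)
    where
    open Reasoning
    x = z zero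
    y = z (suc zero)

    [a-a]b≈0 : ∀ a b → (a - a) * b ≈ 0#
    [a-a]b≈0 a b = trans (*-congʳ (-‿inverseʳ a)) (zeroˡ b)

    Σ[z-x]w≈0 : sum (λ i → (z i - x) * w i) ≈ 0#
    Σ[z-x]w≈0 = trans (+-cong ([a-a]b≈0 x (w zero))
      (Σweights≈0 n (tail z) (λ i → (z (suc i) - x) * w (suc i)) D (distinct-removeAt zero dist)
        (λ i → trans (sym (*-assoc _ _ _)) (trans (*-congʳ (*-comm _ _)) (dw≈D (suc i))))))
      (+-identityʳ 0#)

    Σ[z-y]w≈0 : sum (λ i → (z i - y) * w i) ≈ 0#
    Σ[z-y]w≈0 = trans (sum-remove {i = p} (λ i → (z i - y) * w i)) (trans (+-cong ([a-a]b≈0 y (w p))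
      (Σweights≈0 n (removeAt z p) (λ i → (removeAt z p i - y) * removeAt w p i) D (distinct-removeAt p dist)
        (λ i → trans (sym (*-assoc _ _ _)) (trans (*-congʳ (sym (gaps-removeAt-1 z i))) (dw≈D (punchIn p i))))))
      (+-identityʳ 0#))
      where p = suc zero

  -- p = a[z₀,…,zₙ], the divided difference for the values aᵢ at zᵢ, through a
  -- Newton scheme: bᵢ = a[z₀,zᵢ₊₁], and p = b[z₁,…,zₙ].
  DividedDifference : ∀ n → (z a : Vector Carrier (suc n)) → Carrier → Set (c ⊔ ℓ)
  DividedDifference zero    z a p = Lift c (p ≈ a zero)
  DividedDifference (suc n) z a p = Σ[ b ∈ Vector Carrier (suc n) ]
    (∀ i → b i * (z (suc i) - z zero) ≈ a (suc i) - a zero) × DividedDifference n (tail z) b p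

  -- By induction at z₁,...,zₙ with weights (zᵢ - z₀) wᵢ, p D = Σ b[zᵢ] (zᵢ - z₀) wᵢ = Σ (aᵢ - a₀)
  -- wᵢ over i ≥ 1. Adding a₀ Σ wᵢ, which is zero, removes a₀ from every term and supplies a₀ w₀.
  partialFractions : ∀ n (z a : Vector Carrier (suc n)) {p} → Distinct z → DividedDifference n z a p →
    ∀ (w : Vector Carrier (suc n)) D → (∀ i → gaps z i * w i ≈ D) → p * D ≈ sum (λ i → a i * w i)
  partialFractions zero z a _ (lift p≈a) w D dw≈D = begin
    _ * D               ≈⟨ *-cong p≈a (trans (sym (dw≈D zero)) (*-identityˡ _)) ⟩
    a zero * w zero     ≈⟨ +-identityʳ _ ⟨
    a zero * w zero + 0#  ∎
    where open Reasoning
  partialFractions (suc n) z a {p} dist (b , b-difference , p-difference) w D dw≈D = begin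
    p * D
      ≈⟨ +-identityʳ _ ⟨
    p * D + 0#
      ≈⟨ +-congˡ (trans (*-congˡ (Σweights≈0 n z w D dist dw≈D)) (zeroʳ a₀)) ⟨
    p * D + a₀ * sum w
      ≈⟨ +-congˡ (distribˡ a₀ (w zero) (sum (tail w))) ⟩
    p * D + (a₀ * w zero + a₀ * sum (tail w))
      ≈⟨ +-assoc _ _ _ ⟨
    (p * D + a₀ * w zero) + a₀ * sum (tail w)
      ≈⟨ +-congʳ (+-comm _ _) ⟩
    (a₀ * w zero + p * D) + a₀ * sum (tail w)
      ≈⟨ +-assoc _ _ _ ⟩
    a₀ * w zero + (p * D + a₀ * sum (tail w))
      ≈⟨ +-congˡ (+-cong pD (*-distribˡ-sum a₀ (tail w))) ⟩
    a₀ * w zero + (sum (λ i → (a (suc i) - a₀) * w (suc i)) + sum (λ i → a₀ * w (suc i)))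
      ≈⟨ +-congˡ (∑-distrib-+ (λ i → (a (suc i) - a₀) * w (suc i)) (λ i → a₀ * w (suc i))) ⟨
    a₀ * w zero + sum (λ i → (a (suc i) - a₀) * w (suc i) + a₀ * w (suc i))
      ≈⟨ +-congˡ (sum-cong-≋ (λ i → trans (sym (distribʳ (w (suc i)) _ _)) (*-congʳ (x-y+y≈x (a (suc i)) a₀)))) ⟩
    a₀ * w zero + sum (λ i → a (suc i) * w (suc i))
      ∎
    where
    open Reasoning
    a₀ = a zero
    pD : p * D ≈ sum (λ i → (a (suc i) - a₀) * w (suc i))
    pD = trans
      (partialFractions n (tail z) b (distinct-removeAt zero dist) p-difference
        (λ i → (z (suc i) - z zero) * w (suc i)) D
        (λ i → trans (sym (*-assoc _ _ _)) (trans (*-congʳ (*-comm _ _)) (dw≈D (suc i)))))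
      (sum-cong-≋ (λ i → trans (sym (*-assoc _ _ (w (suc i)))) (*-congʳ (b-difference i))))

  -- The choice D = Πⱼ dⱼ and wᵢ = Π_{j ≠ i} dⱼ, which is the shape demanded by
  -- `_IsSumOfFractions_/_`.
  partialFractions-product : ∀ n (z a : Vector Carrier (suc n)) {p} → Distinct z → DividedDifference n z a p →
    p * product (gaps z) ≈ sum (λ i → a i * product (removeAt (gaps z) i))
  partialFractions-product n z a dist p-difference =
    partialFractions n z a dist p-difference (λ i → product (removeAt (gaps z) i)) (product (gaps z))
      (λ i → sym (product-remove {i = i} (gaps z)))

  cancellable-Πgaps : ∀ {n} (z : Vector Carrier (suc n)) → Distinct z → Cancellable (product (gaps z))
  cancellable-Πgaps z dist = cancellable-product (gaps z) λ i →
    cancellable-product (λ j → z i - removeAt z i j) λ j → dist (punchInᵢ≢i i j ∘ ≡.sym)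

  dividedDifference-cong : ∀ n {z z′ a a′ : Vector Carrier (suc n)} {p p′} →
    (∀ i → z i ≈ z′ i) → (∀ i → a i ≈ a′ i) → p ≈ p′ →
    DividedDifference n z a p → DividedDifference n z′ a′ p′
  dividedDifference-cong zero z≈ a≈ p≈ (lift eq) = lift (trans (sym p≈) (trans eq (a≈ zero)))
  dividedDifference-cong (suc n) z≈ a≈ p≈ (b , b-difference , p-difference) =
    b , (λ i → trans (*-congˡ (+-cong (sym (z≈ (suc i))) (-‿cong (sym (z≈ zero)))))
         (trans (b-difference i) (+-cong (a≈ (suc i)) (-‿cong (a≈ zero)))))
      , dividedDifference-cong n (z≈ ∘ suc) (λ _ → refl) p≈ p-difference

-- Adjoining one variable: non-zero-divisors and divided differences

module PowerSeriesPartialFractions {c ℓ} (A : RawRing c ℓ) (isCR : IsCommutativeRawRing A) where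
  open RawRingProperties A isCR
  open PowerSeriesProperties A isCR
  open PowerSeriesOps A using (X)
  open PartialFractions A isCR
  private
    module P  = PartialFractions (PowerSeries A) powerSeries-isCR
    module PR = RawRingProperties (PowerSeries A) powerSeries-isCR

  cancellable-single : ∀ {d} → Cancellable d → P.Cancellable (single d)
  cancellable-single {d} d-canc f df≈0 k = d-canc (f k) (trans (sym (cauchy-single d f k)) (df≈0 k))

  cancellable-X : P.Cancellable X
  cancellable-X f Xf≈0 k = trans (sym (cauchy-X-suc f k)) (Xf≈0 (suc k))

  cauchy-single-X : ∀ f d {x} → x ≋ X → ∀ k →
                    cauchy f (single d PR.- x) k ≈ d * f k - cauchy X f k
  cauchy-single-X f d {x} x≋X k = trans (PR.x[y-z]≈xy-xz f (single d) x k) (+-cong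
    (trans (cauchy-comm f (single d) k) (cauchy-single d f k))
    (-‿cong (trans (cauchy-comm f x k) (cauchy-cong {g = f} x≋X (λ _ → refl) k))))

  -- From X f = d f follow d f₀ = 0 and d fₖ₊₁ = fₖ; cancelling d kills the coefficients one after
  -- another.
  cancellable-X-single : ∀ {d} → Cancellable d → P.Cancellable (X PR.- single d)
  cancellable-X-single {d} d-canc f eq = go
    where
    open Reasoning
    expand : ∀ k → cauchy X f k ≈ d * f k
    expand k = begin
      cauchy X f k                       ≈⟨ x-y+y≈x _ _ ⟨
      (cauchy X f k - cauchy (single d) f k) + cauchy (single d) f k
        ≈⟨ +-congʳ (trans (sym (PR.[y-z]x≈yx-zx f X (single d) k)) (eq k)) ⟩
      0# + cauchy (single d) f k         ≈⟨ +-identityˡ _ ⟩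
      cauchy (single d) f k              ≈⟨ cauchy-single d f k ⟩
      d * f k                            ∎
    go : ∀ k → f k ≈ 0#
    go zero    = d-canc (f 0) (trans (sym (expand 0)) (cauchy-X-zero f))
    go (suc k) = d-canc (f (suc k)) (trans (sym (expand (suc k))) (trans (cauchy-X-suc f k) (go k)))

  -- The new variable minus an old point zᵢ is cancellable because zᵢ itself is, hence the extra
  -- hypothesis. The first point is asked to be X only up to `≈`, since `z` builds it through
  -- `constant`.
  distinct-∷ : ∀ {n} (z : Vector Carrier n) (v : Vector PR.Carrier (suc n)) →
    Distinct z → (∀ i → Cancellable (z i)) →
    v zero PR.≈ X → (∀ i → v (suc i) ≡ single (z i)) → P.Distinct v
  distinct-∷ z v dist z-canc v₀≈X v≡z {zero} {zero} i≢j = contradiction ≡.refl i≢j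
  distinct-∷ z v dist z-canc v₀≈X v≡z {zero} {suc j} _ =
    P.cancellable-resp-≈ (λ k → +-cong (sym (v₀≈X k)) (-‿cong (reflexive (≡.cong (λ h → h k) (≡.sym (v≡z j))))))
      (cancellable-X-single (z-canc j))
  distinct-∷ z v dist z-canc v₀≈X v≡z {suc i} {zero} _ =
    P.cancellable-resp-≈ {PR.- (X PR.- single (z i))}
      (λ k → trans (trans (sym (-‿+-comm _ _)) (trans (+-comm _ _) (+-congʳ (-‿involutive _))))
             (+-cong (reflexive (≡.cong (λ h → h k) (≡.sym (v≡z i)))) (-‿cong (sym (v₀≈X k)))))
      (P.cancellable-neg {X PR.- single (z i)} (cancellable-X-single (z-canc i)))
  distinct-∷ z v dist z-canc v₀≈X v≡z {suc i} {suc j} i≢j rewrite v≡z i | v≡z j =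
    P.cancellable-resp-≈ (λ k → sym (single-- (z i) (z j) k))
      (cancellable-single (dist (i≢j ∘ ≡.cong suc)))

  -- The points do not involve the new variable, so the Newton scheme acts on each of its powers
  -- separately.
  dividedDifference-single : ∀ n (z : Vector Carrier (suc n)) (b : ℕ → Vector Carrier (suc n)) (p : ℕ → Carrier) →
    (∀ k → DividedDifference n z (b k) (p k)) →
    P.DividedDifference n (single ∘ z) (λ i k → b k i) p
  dividedDifference-single zero    z b p dd = lift (λ k → lower (dd k))
  dividedDifference-single (suc n) z b p dd =
      (λ i k → proj₁ (dd k) i)
    , (λ i k → let bᵢ = λ j → proj₁ (dd j) i
                   dᵢ = z (suc i) - z zero in begin
        cauchy bᵢ (single (z (suc i)) PR.- single (z zero)) k
          ≈⟨ cauchy-cong {bᵢ} (λ _ → refl) (single-- (z (suc i)) (z zero)) k ⟩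
        cauchy bᵢ (single dᵢ) k          ≈⟨ cauchy-comm bᵢ (single dᵢ) k ⟩
        cauchy (single dᵢ) bᵢ k          ≈⟨ cauchy-single dᵢ bᵢ k ⟩
        dᵢ * bᵢ k                        ≈⟨ *-comm _ _ ⟩
        bᵢ k * dᵢ                        ≈⟨ proj₁ (proj₂ (dd k)) i ⟩
        b k (suc i) - b k zero           ∎)
    , dividedDifference-single n (tail z) (λ k → proj₁ (dd k)) p (λ k → proj₂ (proj₂ (dd k)))
    where open Reasoning

-- The indeterminates zᵢ and divided differences at them

module Variables {c ℓ} (R : CommutativeRing c ℓ) where
  open Setup R

  R⟦z⟧-isCR : ∀ n → IsCommutativeRawRing (R⟦z⟧ n)
  R⟦z⟧-isCR zero    = CommutativeRing.isCommutativeRing R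
  R⟦z⟧-isCR (suc n) = PowerSeriesProperties.powerSeries-isCR (R⟦z⟧ n) (R⟦z⟧-isCR n)

  module Z  n = RawRingProperties (R⟦z⟧ n) (R⟦z⟧-isCR n)
  module ZP n = PowerSeriesProperties (R⟦z⟧ n) (R⟦z⟧-isCR n)
  module PF n = PartialFractions (R⟦z⟧ n) (R⟦z⟧-isCR n)
  module PP n = PowerSeriesPartialFractions (R⟦z⟧ n) (R⟦z⟧-isCR n)
  private module R = CommutativeRing R

  constant-cong : ∀ n {a b} → a R.≈ b → Z._≈_ n (constant n a) (constant n b)
  constant-cong zero    a≈b = a≈b
  constant-cong (suc n) a≈b = ZP.single-cong n (constant-cong n a≈b)

  constant-0 : ∀ n → Z._≈_ n (constant n R.0#) (Z.0# n)
  constant-0 zero    = R.refl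
  constant-0 (suc n) = ZP.single-zero n (constant-0 n)

  constant-1 : ∀ n → Z._≈_ n (constant n R.1#) (Z.1# n)
  constant-1 zero    = R.refl
  constant-1 (suc n) = ZP.single-cong n (constant-1 n)

  z-zero : ∀ n k → Z._≈_ n (z (suc n) zero k) (PowerSeriesOps.X (R⟦z⟧ n) k)
  z-zero n zero          = constant-0 n
  z-zero n (suc zero)    = constant-1 n
  z-zero n (suc (suc k)) = constant-0 n

  z-cancellable : ∀ n i → PF.Cancellable n (z n i)
  z-cancellable (suc n) zero    =
    PF.cancellable-resp-≈ (suc n) (λ k → Z.sym n (z-zero n k)) (PP.cancellable-X n)
  z-cancellable (suc n) (suc i) = PP.cancellable-single n (z-cancellable n i)

  z-distinct : ∀ n → PF.Distinct n (z n)
  z-distinct (suc n) = PP.distinct-∷ n (z n) (z (suc n)) (z-distinct n) (z-cancellable n)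
    (z-zero n) (λ _ → ≡.refl)

  atVariable-cong : ∀ n i {q q′ : ℕ → R.Carrier} → (∀ j → q j R.≈ q′ j) →
                    Z._≈_ n (atVariable n i q) (atVariable n i q′)
  atVariable-cong (suc n) zero    q≈q′ k = constant-cong n (q≈q′ k)
  atVariable-cong (suc n) (suc i) q≈q′   = ZP.single-cong n (atVariable-cong n i q≈q′)

  -- Horner's rule; read backwards, it turns zᵢ times a shifted series into a difference.
  atVariable-step : ∀ n i (q : ℕ → R.Carrier) → let open Z n in
    atVariable n i q ≈ constant n (q 0) + z n i * atVariable n i (q ∘ suc)
  atVariable-step (suc n) zero q = go
    where
    open Z n
    tq = atVariable (suc n) zero (q ∘ suc)
    go : ∀ k → constant n (q k) ≈ constant (suc n) (q 0) k + cauchy (z (suc n) zero) tq k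
    z₀* : ∀ k → cauchy (z (suc n) zero) tq k ≈ cauchy (PowerSeriesOps.X (R⟦z⟧ n)) tq k
    z₀* = ZP.cauchy-cong n {g = tq} (z-zero n) (λ _ → refl)
    go zero    = sym (trans (+-congˡ (trans (z₀* 0) (ZP.cauchy-X-zero n tq))) (+-identityʳ _))
    go (suc k) = sym (trans (+-congˡ (trans (z₀* (suc k)) (ZP.cauchy-X-suc n tq k))) (+-identityˡ _))
  atVariable-step (suc n) (suc i) q = go
    where
    open Z n
    a b : RawRing.Carrier (R⟦z⟧ n)
    a = z n i
    b = atVariable n i (q ∘ suc)
    go : ∀ k → single (atVariable n i q) k ≈ constant (suc n) (q 0) k + cauchy (single a) (single b) k
    go zero    = trans (atVariable-step n i q) (+-congˡ (sym (ZP.single-* n a b zero)))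
    go (suc k) = sym (trans (+-congˡ (ZP.single-* n a b (suc k))) (+-identityʳ _))

  -- H n p = Σ p(k₁ + ⋯ + kₙ) z₁^k₁ ⋯ zₙ^kₙ, so that H takes the sequence p to
  -- Σₘ p(m) hₘ with hₘ the complete homogeneous symmetric polynomials.
  H : ∀ n → (ℕ → R.Carrier) → RawRing.Carrier (R⟦z⟧ n)
  H zero    p = p 0
  H (suc n) p = λ k → H n (λ j → p (j ℕ.+ k))

  H-cong : ∀ n {p p′ : ℕ → R.Carrier} → (∀ j → p j R.≈ p′ j) → Z._≈_ n (H n p) (H n p′)
  H-cong zero    p≈p′   = p≈p′ 0
  H-cong (suc n) p≈p′ k = H-cong n (λ j → p≈p′ (j ℕ.+ k))

  -- Divided differences of q at z₀,…,zₙ: the m-th power contributes h_{m−n}.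
  H-dividedDifference : ∀ n (q : ℕ → R.Carrier) →
    PF.DividedDifference (suc n) n (z (suc n)) (λ i → atVariable (suc n) i q) (H (suc n) (λ j → q (j ℕ.+ n)))
  H-dividedDifference zero q = lift λ k → R.reflexive (≡.cong q (ℕ.+-identityʳ k))
  H-dividedDifference (suc n) q = b , difference ,
    PF.dividedDifference-cong (suc (suc n)) n (λ _ _ → Z.refl (suc n)) (λ _ _ → Z.refl (suc n)) p≈
      (PP.dividedDifference-single (suc n) n (z (suc n)) (λ k i → b i k) (λ k → H (suc n) (λ j → q (j ℕ.+ n ℕ.+ suc k)))
        (λ k → H-dividedDifference n (λ j → q (j ℕ.+ suc k))))
    where
    open Z (suc n)
    open Reasoning
    -- (q(z) - q(z₀))/(z - z₀) = Σₖ z₀ᵏ Σⱼ q(j + k + 1) zʲ; the added 1 is the degree lost in the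
    -- division.
    b : Vector (RawRing.Carrier (R⟦z⟧ (suc (suc n)))) (suc n)
    b i k = atVariable (suc n) i (λ j → q (j ℕ.+ suc k))

    p≈ : ∀ k → H (suc n) (λ j → q (j ℕ.+ n ℕ.+ suc k)) ≈ H (suc n) (λ j → q (j ℕ.+ k ℕ.+ suc n))
    p≈ k = H-cong (suc n) λ j → R.reflexive (≡.cong q (≡.trans (ℕ.+-assoc j n (suc k))
      (≡.trans (≡.cong (j ℕ.+_) (≡.trans (ℕ.+-suc n k) (ℕ.+-comm (suc n) k))) (≡.sym (ℕ.+-assoc j k (suc n))))))

    difference : ∀ i k → cauchy (b i) (λ j → z (suc (suc n)) (suc i) j - z (suc (suc n)) zero j) k
                       ≈ single (atVariable (suc n) i q) k - constant (suc n) (q k)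
    difference i k =
      trans (PP.cauchy-single-X (suc n) (b i) (z (suc n) i) {z (suc (suc n)) zero} (z-zero (suc n)) k) (go k)
      where
      step : ∀ (q : ℕ → R.Carrier) →
             z (suc n) i * atVariable (suc n) i (q ∘ suc) ≈ atVariable (suc n) i q - constant (suc n) (q 0)
      step q = begin
        z (suc n) i * atVariable (suc n) i (q ∘ suc)
          ≈⟨ trans (+-congˡ (-‿inverseʳ c₀)) (+-identityʳ _) ⟨
        z (suc n) i * atVariable (suc n) i (q ∘ suc) + (c₀ - c₀)
          ≈⟨ +-assoc _ c₀ (- c₀) ⟨
        (z (suc n) i * atVariable (suc n) i (q ∘ suc) + c₀) - c₀
          ≈⟨ +-congʳ (trans (+-comm _ c₀) (sym (atVariable-step (suc n) i q))) ⟩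
        atVariable (suc n) i q - constant (suc n) (q 0)  ∎
        where c₀ = constant (suc n) (q 0)
      -- Coefficient of z₀ᵏ in b · (z - z₀), namely z bₖ - bₖ₋₁. By Horner's rule z bₖ = bₖ₋₁ - q(k)
      -- for k > 0, so only -q(k) survives; for k = 0 the value is q(z) - q(0).
      go : ∀ k → z (suc n) i * b i k - cauchy (PowerSeriesOps.X (R⟦z⟧ (suc n))) (b i) k
               ≈ single (atVariable (suc n) i q) k - constant (suc n) (q k)
      go zero = begin
        z (suc n) i * b i 0 - cauchy (PowerSeriesOps.X (R⟦z⟧ (suc n))) (b i) 0
          ≈⟨ trans (+-congˡ (-‿cong (ZP.cauchy-X-zero (suc n) (b i)))) (x-0≈x _) ⟩
        z (suc n) i * b i 0
          ≈⟨ *-congˡ {z (suc n) i} (atVariable-cong (suc n) i λ j → R.reflexive (≡.cong q (ℕ.+-comm j 1))) ⟩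
        z (suc n) i * atVariable (suc n) i (q ∘ suc)
          ≈⟨ step q ⟩
        atVariable (suc n) i q - constant (suc n) (q 0)  ∎
      go (suc k) = begin
        z (suc n) i * b i (suc k) - cauchy (PowerSeriesOps.X (R⟦z⟧ (suc n))) (b i) (suc k)
          ≈⟨ +-cong
               (trans (*-congˡ {z (suc n) i} (atVariable-cong (suc n) i λ j →
                         R.reflexive (≡.cong q (ℕ.+-suc j (suc k)))))
                      (step (λ j → q (j ℕ.+ suc k))))
               (-‿cong (ZP.cauchy-X-suc (suc n) (b i) k)) ⟩
        (b i k - constant (suc n) (q (suc k))) - b i k
          ≈⟨ +-comm _ _ ⟩
        - b i k + (b i k - constant (suc n) (q (suc k)))
          ≈⟨ +-assoc _ _ _ ⟨
        (- b i k + b i k) - constant (suc n) (q (suc k))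
          ≈⟨ +-congʳ (-‿inverseˡ (b i k)) ⟩
        0# - constant (suc n) (q (suc k))  ∎

-- Existence and uniqueness of the sum of fractions

module PartialFractionSum {c ℓ} (R : CommutativeRing c ℓ) (n : ℕ) where
  open Setup R
  open Variables R
  private
    module R  = CommutativeRing R
    module Rx = LaurentOps R.rawRing
    zs = z (suc n)

  open Z (suc n)
  open PF (suc n)
  open LaurentProperties (R⟦z⟧ (suc n)) (R⟦z⟧-isCR (suc n))
  open LaurentOps (R⟦z⟧ (suc n))
  private
    module L = RawRing (R⟦z⟧⦅t⦆ (suc n))
    module LL = RawRingProperties (R⟦z⟧⦅t⦆ (suc n)) laurent-isCR

  -- Σₘ aₘ hₘ₋ₙ(z₁,...,zₙ₊₁) over m ≥ n, the n-th divided difference of the nonnegative part of a.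
  divided : RawRing.Carrier R⦅x⦆ → RawRing.Carrier (R⟦z⟧ (suc n))
  divided a = H (suc n) (λ j → Rx.nonnegative a (j ℕ.+ n))

  -- The denominators are constant in t, so the equation between Laurent series splits into one
  -- equation in R[[z]] for each power of t.
  coeff-*Π : ∀ P m → coeff (P L.* LL.product (Πz-z n)) m ≈ coeff P m * product (gaps zs)
  coeff-*Π P m = trans (LL.*-congˡ {P} (const-product (gaps zs)) m) (coeff-*-const P (product (gaps zs)) m)

  coeff-numerator : ∀ Q m →
    coeff (LL.sum (λ i → at-z (suc n) Q i L.* LL.product (removeAt (Πz-z n) i))) m
    ≈ sum (λ i → coeff (at-z (suc n) Q i) m * product (removeAt (gaps zs) i))
  coeff-numerator Q m = trans
    (coeff-sum (λ i → at-z (suc n) Q i L.* LL.product (removeAt (Πz-z n) i)) m)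
    (sum-cong-≋ λ i → trans (LL.*-congˡ {at-z (suc n) Q i} (const-product (removeAt (gaps zs) i)) m)
                            (coeff-*-const (at-z (suc n) Q i) _ m))

  divided-isPartialFractionSum : ∀ Q → IsPartialFractionSum n Q (mapCoeffs divided Q)
  divided-isPartialFractionSum Q m =
    trans (coeff-*Π (mapCoeffs divided Q) m) (trans core (sym (coeff-numerator Q m)))
    where
    core : coeff (mapCoeffs divided Q) m * product (gaps zs)
         ≈ sum (λ i → coeff (at-z (suc n) Q i) m * product (removeAt (gaps zs) i))
    core with m ℤ.- order Q
    ... | + k = partialFractions-product n zs (λ i → atVariable (suc n) i q) (z-distinct (suc n))
                  (H-dividedDifference n q)
      where q = Rx.nonnegative (coeffs Q k)
    ... | -[1+ _ ] = trans (zeroˡ _) (sym (trans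
                       (sum-cong-≋ (λ i → zeroˡ (product (removeAt (gaps zs) i)))) (sum-replicate-zero (suc n))))

  unique : ∀ Q {P P′} → IsPartialFractionSum n Q P → IsPartialFractionSum n Q P′ → P L.≈ P′
  unique Q {P} {P′} P-sum P′-sum m = cancel {product (gaps zs)} (cancellable-Πgaps zs (z-distinct (suc n))) (begin
    D * coeff P m                         ≈⟨ *-comm D _ ⟩
    coeff P m * D                         ≈⟨ coeff-*Π P m ⟨
    coeff (P L.* LL.product (Πz-z n)) m   ≈⟨ trans (P-sum m) (sym (P′-sum m)) ⟩
    coeff (P′ L.* LL.product (Πz-z n)) m  ≈⟨ coeff-*Π P′ m ⟩
    coeff P′ m * D                        ≈⟨ *-comm _ D ⟩
    D * coeff P′ m                        ∎)
    where
    open Reasoning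
    D = product (gaps zs)

  partialFractionSum : ∀ Q → ∃! (RawRing._≈_ (R⟦z⟧⦅t⦆ (suc n))) (IsPartialFractionSum n Q)
  partialFractionSum Q = mapCoeffs divided Q , divided-isPartialFractionSum Q , unique Q (divided-isPartialFractionSum Q)

-- Families of power series with Fₖ divisible by tᵏ

module Convergence {c ℓ} (A : RawRing c ℓ) (isCR : IsCommutativeRawRing A) where
  open RawRingProperties A isCR
  open PowerSeriesProperties A isCR
  open PowerSeriesOps A
  private module T = RawRingProperties (PowerSeries A) powerSeries-isCR

  VanishesBelow : ℕ → (ℕ → Carrier) → Set ℓ
  VanishesBelow k f = ∀ {l} → l ℕ.< k → f l ≈ 0#

  cauchy-vanishesBelow : ∀ {k} f {g} → VanishesBelow k g → VanishesBelow k (cauchy f g)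
  cauchy-vanishesBelow f {g} g-vanishes {l} l<k = Σ-zero l λ i →
    trans (*-congˡ (g-vanishes (ℕ.≤-<-trans (ℕ.m∸n≤m l i) l<k))) (zeroʳ (f i))

  cauchy-vanishesBelow-suc : ∀ {k} {f g} → f 0 ≈ 0# → VanishesBelow k g → VanishesBelow (suc k) (cauchy f g)
  cauchy-vanishesBelow-suc {f = f} {g} f₀≈0 g-vanishes {zero} _ =
    trans (+-identityʳ _) (trans (*-congʳ f₀≈0) (zeroˡ (g 0)))
  cauchy-vanishesBelow-suc {f = f} {g} f₀≈0 g-vanishes {suc l} (s≤s l<k) =
    trans (+-cong (trans (*-congʳ f₀≈0) (zeroˡ (g (suc l)))) (cauchy-vanishesBelow (f ∘ suc) {g} g-vanishes l<k))
          (+-identityʳ 0#)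

  ^-vanishesBelow : ∀ {f} → f 0 ≈ 0# → ∀ k → VanishesBelow k (f T.^ k)
  ^-vanishesBelow f₀≈0 zero    ()
  ^-vanishesBelow {f} f₀≈0 (suc k) = cauchy-vanishesBelow-suc {f = f} f₀≈0 (^-vanishesBelow f₀≈0 k)

  Σ∞-cong : ∀ {F G} → (∀ k → F k ≋ G k) → Σ∞ F ≋ Σ∞ G
  Σ∞-cong F≋G l = Σ-cong l (λ k → F≋G k l)

  -- At tˡ the inner sums stop at l ∸ i. Divisibility of F k by tᵏ lets them all run to l, after
  -- which the sums over i and k can be exchanged.
  cauchy-Σ∞ : ∀ f F → (∀ k → VanishesBelow k (F k)) → cauchy f (Σ∞ F) ≋ Σ∞ (λ k → cauchy f (F k))
  cauchy-Σ∞ f F F-vanishes l = begin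
    Σ[0⋯ l ] (λ i → f i * Σ[0⋯ l ∸ i ] (λ k → F k (l ∸ i)))
      ≈⟨ Σ-cong l (λ i → *-congˡ {f i} (Σ-truncate (λ k → F k (l ∸ i)) (ℕ.m∸n≤m l i)
           (λ k l∸i<k → F-vanishes k l∸i<k))) ⟨
    Σ[0⋯ l ] (λ i → f i * Σ[0⋯ l ] (λ k → F k (l ∸ i)))
      ≈⟨ Σ-cong l (λ i → Σ-*ˡ l (f i) (λ k → F k (l ∸ i))) ⟩
    Σ[0⋯ l ] (λ i → Σ[0⋯ l ] (λ k → f i * F k (l ∸ i)))
      ≈⟨ Σ-swap l l (λ i k → f i * F k (l ∸ i)) ⟩
    Σ[0⋯ l ] (λ k → cauchy f (F k) l)  ∎
    where open Reasoning

  cauchy-X^ : ∀ G {i l} → i ℕ.≤ l → cauchy (X T.^ i) G l ≈ G (l ∸ i)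
  cauchy-X^ G {zero}  {l} z≤n = cauchy-identityˡ G l
  cauchy-X^ G {suc i} {suc l} (s≤s i≤l) = begin
    cauchy (cauchy X (X T.^ i)) G (suc l)  ≈⟨ cauchy-assoc X (X T.^ i) G (suc l) ⟩
    cauchy X (cauchy (X T.^ i) G) (suc l)  ≈⟨ cauchy-X-suc (cauchy (X T.^ i) G) l ⟩
    cauchy (X T.^ i) G l                   ≈⟨ cauchy-X^ G i≤l ⟩
    G (l ∸ i)                              ∎
    where open Reasoning

  X^*-vanishesBelow : ∀ i G → VanishesBelow i (cauchy (X T.^ i) G)
  X^*-vanishesBelow i G {l} l<i =
    trans (cauchy-comm (X T.^ i) G l) (cauchy-vanishesBelow G (^-vanishesBelow {X} refl i) l<i)

  -- Brings the series built by `substitute` to the diagonal form in which coefficients of products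
  -- in t appear.
  Σ∞-X^ : ∀ (G : ℕ → ℕ → Carrier) l → Σ∞ (λ i → cauchy (X T.^ i) (G i)) l ≈ Σ[0⋯ l ] (λ i → G i (l ∸ i))
  Σ∞-X^ G l = Σ-cong-≤ l (λ i i≤l → cauchy-X^ (G i) {i} {l} i≤l)

-- Evaluation of power series at the uᵢ

module Evaluation {c ℓ} (R : CommutativeRing c ℓ) where
  open Setup R
  open Variables R
  private
    isCR = CommutativeRing.isCommutativeRing R
    module T  = RawRingProperties R⟦t⟧ (PowerSeriesProperties.powerSeries-isCR rawRing isCR)
  open RawRingProperties rawRing isCR
  open PowerSeriesProperties rawRing isCR
  open PowerSeriesOps rawRing
  open Convergence rawRing isCR
  open LaurentProperties rawRing isCR using (pad)

  private module S {n} (u : Vector T.Carrier (suc n)) (p : ℕ → RawRing.Carrier (R⟦z⟧ n)) where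
    term : ℕ → ℕ → Carrier
    term k = cauchy (Vector.head u T.^ k) (eval n (p k) (Vector.tail u))

  eval-cong : ∀ n {p p′} (u : Vector T.Carrier n) → Z._≈_ n p p′ → eval n p u ≋ eval n p′ u
  eval-cong zero    u p≈p′ = single-cong p≈p′
  eval-cong (suc n) {p} {p′} u p≈p′ = Σ∞-cong {S.term u p} {S.term u p′} λ k →
    cauchy-cong {Vector.head u T.^ k} (λ _ → refl) (eval-cong n (Vector.tail u) (p≈p′ k))

  eval-zero : ∀ n {p} (u : Vector T.Carrier n) → Z._≈_ n p (Z.0# n) → ∀ l → eval n p u l ≈ 0#
  eval-zero zero    u p≈0 = single-zero p≈0
  eval-zero (suc n) {p} u p≈0 l = Σ-zero l λ k → Σ-zero l λ i →
    trans (*-congˡ (eval-zero n (Vector.tail u) (p≈0 k) (l ∸ i))) (zeroʳ ((Vector.head u T.^ k) i))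

  H-zero : ∀ n {p} → (∀ j → p j ≈ 0#) → Z._≈_ n (H n p) (Z.0# n)
  H-zero zero    p≈0   = p≈0 0
  H-zero (suc n) p≈0 k = H-zero n (λ j → p≈0 (j ℕ.+ k))

  module OneVariable (u : T.Carrier) (u₀≈0 : ZeroConstantTerm u) where

    eval₁ : (ℕ → Carrier) → T.Carrier
    eval₁ p = eval 1 p (λ _ → u)

    private
      term : (ℕ → Carrier) → ℕ → T.Carrier
      term p k = cauchy (u T.^ k) (single (p k))

      term-vanishesBelow : ∀ p k → VanishesBelow k (term p k)
      term-vanishesBelow p k {l} l<k = trans (cauchy-comm (u T.^ k) (single (p k)) l)
        (cauchy-vanishesBelow (single (p k)) (^-vanishesBelow u₀≈0 k) l<k)

      term-zero : ∀ p k → p k ≈ 0# → ∀ l → term p k l ≈ 0#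
      term-zero p k pk≈0 l = trans (cauchy-comm (u T.^ k) (single (p k)) l)
        (cauchy-zeroˡ (u T.^ k) (single-zero pk≈0) l)

    eval₁-single : ∀ a → eval₁ (single a) ≋ single a
    eval₁-single a zero    = trans (+-identityʳ _) (cauchy-identityˡ (single a) zero)
    eval₁-single a (suc l) = trans
      (+-cong (cauchy-identityˡ (single a) (suc l)) (Σ-zero l (λ k → term-zero (single a) (suc k) refl (suc l))))
      (+-identityʳ 0#)

    eval₁-shift : ∀ a p → eval₁ (pad (suc a) p) ≋ cauchy u (eval₁ (pad a p))
    eval₁-shift a p l = begin
      Σ[0⋯ l ] (λ k → term p⁺ k l)
        -- The term k = l + 1 is added, harmlessly because uˡ⁺¹ is divisible by tˡ⁺¹, so that after
        -- losing k = 0 the sum still has its full range.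
        ≈⟨ Σ-truncate (λ k → term p⁺ k l) (ℕ.n≤1+n l) (λ k l<k → term-vanishesBelow p⁺ k l<k) ⟨
      term p⁺ 0 l + Σ[0⋯ l ] (λ k → term p⁺ (suc k) l)
        ≈⟨ trans (+-congʳ (term-zero p⁺ 0 refl l)) (+-identityˡ _) ⟩
      Σ[0⋯ l ] (λ k → term p⁺ (suc k) l)
        ≈⟨ Σ-cong l (λ k → cauchy-assoc u (u T.^ k) (single (pad a p k)) l) ⟩
      Σ[0⋯ l ] (λ k → cauchy u (term (pad a p) k) l)
        ≈⟨ cauchy-Σ∞ u (term (pad a p)) (term-vanishesBelow (pad a p)) l ⟨
      cauchy u (eval₁ (pad a p)) l  ∎
      where
      open Reasoning
      p⁺ = pad (suc a) p

    -- (zᵃ p)(u) = uᵃ p(u), the instance of multiplicativity of evaluation that the residues call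
    -- for.
    eval₁-pad : ∀ a p → eval₁ (pad a p) ≋ cauchy (u T.^ a) (eval₁ p)
    eval₁-pad zero    p l = sym (cauchy-identityˡ (eval₁ p) l)
    eval₁-pad (suc a) p l = begin
      eval₁ (pad (suc a) p) l                 ≈⟨ eval₁-shift a p l ⟩
      cauchy u (eval₁ (pad a p)) l            ≈⟨ cauchy-cong {u} (λ _ → refl) (eval₁-pad a p) l ⟩
      cauchy u (cauchy (u T.^ a) (eval₁ p)) l  ≈⟨ cauchy-assoc u (u T.^ a) (eval₁ p) l ⟨
      cauchy (u T.^ suc a) (eval₁ p) l        ∎
      where open Reasoning

-- Coefficients in x of products with 1/(x - uᵢ)

module Residues {c ℓ} (R : CommutativeRing c ℓ) where
  open Setup R
  open Variables R
  open Evaluation R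
  private
    isCR = CommutativeRing.isCommutativeRing R
    module T  = RawRingProperties R⟦t⟧ (PowerSeriesProperties.powerSeries-isCR rawRing isCR)
    isCR-x = LaurentProperties.laurent-isCR rawRing isCR
    module X  = RawRingProperties R⦅x⦆ isCR-x
    module XP = PowerSeriesProperties R⦅x⦆ isCR-x
    module LX = LaurentProperties R⦅x⦆ isCR-x
  open RawRingProperties rawRing isCR
  open PowerSeriesProperties rawRing isCR
  open Convergence rawRing isCR
  open LaurentProperties rawRing isCR
  open LaurentOps rawRing

  coeff-Σ : ∀ n f m → coeff (X.Σ[0⋯ n ] f) m ≈ Σ[0⋯ n ] (λ k → coeff (f k) m)
  coeff-Σ n f m = coeff-sum {suc n} (f ∘ toℕ) m

  coeff-*-monomial : ∀ f o m → coeff (f X.* monomial o 1#) m ≈ coeff f (m ℤ.- o)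
  coeff-*-monomial f o m = begin
    coeff (f X.* monomial o 1#) m
      ≈⟨ ⟨⟩-cong {order f ℤ.+ o} ≡.refl
           (λ k → trans (cauchy-comm (coeffs f) (single 1#) k) (cauchy-identityˡ (coeffs f) k)) m ⟩
    coeff ((order f ℤ.+ o) ⟨ coeffs f ⟩) m
      ≡⟨ coeff≡extend ((order f ℤ.+ o) ⟨ coeffs f ⟩) m ⟩
    extend (coeffs f) (m ℤ.- (order f ℤ.+ o))
      ≡⟨ ≡.cong (extend (coeffs f)) (lemma m (order f) o) ⟩
    extend (coeffs f) ((m ℤ.- o) ℤ.- order f)
      ≡⟨ coeff≡extend f (m ℤ.- o) ⟨
    coeff f (m ℤ.- o)  ∎
    where
    open Reasoning
    lemma : ∀ m a o → m ℤ.- (a ℤ.+ o) ≡ (m ℤ.- o) ℤ.- a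
    lemma = solve-∀

  monomial-scale : ∀ o a → monomial o a X.≈ (const a X.* monomial o 1#)
  monomial-scale o a = ⟨⟩-cong (≡.sym (ℤ.+-identityˡ o)) λ k →
    sym (trans (single-* a 1# k) (single-cong (*-identityʳ a) k))

  -- 1/(x - u) has no negative powers of t, so products of such factors can be formed in
  -- R((x))[[t]]; their orders in t add up to 0 by computation, which makes `Π1/[x-]≡` an identity
  -- of terms.
  inverse : T.Carrier → ℕ → X.Carrier
  inverse u = PowerSeriesOps.Σ∞ R⦅x⦆ λ k l → monomial -[1+ k ] ((u T.^ k) l)

  Πinverse : ∀ {n} → Vector T.Carrier n → ℕ → X.Carrier
  Πinverse u = Ops.product (PowerSeries R⦅x⦆) (λ i → inverse (u i))

  Π1/[x-]≡ : ∀ {n} (u : Vector T.Carrier n) → Π1/[x- u ] ≡ LaurentOps.fromPowerSeries R⦅x⦆ (Πinverse u)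
  Π1/[x-]≡ {zero}  u = ≡.refl
  Π1/[x-]≡ {suc n} u = ≡.cong (λ f → RawRing._*_ R⦅x⦆⦅t⦆ 1/[x- u zero ] f) (Π1/[x-]≡ (u ∘ suc))

  -- The bound j may exceed i so that all powers of t up to j share one range of k. The factor
  -- x^(-1-k) is attached to b, leaving g free for an induction on the number of factors.
  coeff-*-inverse-* : ∀ u → ZeroConstantTerm u → ∀ b g m {i j} → i ℕ.≤ j →
    coeff (b X.* (inverse u i X.* g)) m
    ≈ Σ[0⋯ j ] (λ k → (u T.^ k) i * coeff ((b X.* monomial -[1+ k ] 1#) X.* g) m)
  coeff-*-inverse-* u u₀≈0 b g m {i} {j} i≤j = begin
    coeff (b X.* (inverse u i X.* g)) m
      ≈⟨ X.*-congˡ {b} (X.*-congʳ {g} (X.Σ-truncate (λ k → M k) i≤j M-vanishes)) m ⟨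
    coeff (b X.* (X.Σ[0⋯ j ] M X.* g)) m
      ≈⟨ X.*-congˡ {b} (X.Σ-*ʳ j g M) m ⟩
    coeff (b X.* X.Σ[0⋯ j ] (λ k → M k X.* g)) m
      ≈⟨ X.Σ-*ˡ j b (λ k → M k X.* g) m ⟩
    coeff (X.Σ[0⋯ j ] (λ k → b X.* (M k X.* g))) m
      ≈⟨ coeff-Σ j (λ k → b X.* (M k X.* g)) m ⟩
    Σ[0⋯ j ] (λ k → coeff (b X.* (M k X.* g)) m)
      ≈⟨ Σ-cong j scale ⟩
    Σ[0⋯ j ] (λ k → (u T.^ k) i * coeff ((b X.* monomial -[1+ k ] 1#) X.* g) m)  ∎
    where
    open Reasoning
    M : ℕ → X.Carrier
    M k = monomial -[1+ k ] ((u T.^ k) i)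
    M-vanishes : ∀ k → i ℕ.< k → M k X.≈ X.0#
    M-vanishes k i<k m = trans (coeff-monomial-zero -[1+ k ] (^-vanishesBelow u₀≈0 k i<k) m) (sym (coeff-0 m))
    scale : ∀ k → coeff (b X.* (M k X.* g)) m ≈ (u T.^ k) i * coeff ((b X.* monomial -[1+ k ] 1#) X.* g) m
    scale k = trans (rearranged m) (coeff-const-* a ((b X.* N) X.* g) m)
      where
      a = (u T.^ k) i
      N = monomial -[1+ k ] 1#
      rearranged : (b X.* (M k X.* g)) X.≈ (const a X.* ((b X.* N) X.* g))
      rearranged = X.trans (X.*-congˡ {b} (X.trans (X.*-congʳ {g} (monomial-scale -[1+ k ] a))
                                                   (X.*-assoc (const a) N g)))
        (X.trans (X.sym (X.*-assoc b (const a) (N X.* g)))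
        (X.trans (X.*-congʳ {N X.* g} (X.*-comm b (const a)))
        (X.trans (X.*-assoc (const a) b (N X.* g))
                 (X.*-congˡ {const a} (X.sym (X.*-assoc b N g))))))

  -- Expanding Π 1/(x − uᵢ) = Σ u₁^k₁ ⋯ uₙ^kₙ x^{−n−k₁−⋯−kₙ}.
  constantTerm-Πinverse : ∀ n (u : Vector T.Carrier n) → (∀ i → ZeroConstantTerm (u i)) → ∀ b j →
    coeff (b X.* Πinverse u j) (+ 0) ≈ eval n (H n (λ k → coeff b (+ (n ℕ.+ k)))) u j
  constantTerm-Πinverse zero u u₀≈0 b zero    = X.*-identityʳ b (+ 0)
  constantTerm-Πinverse zero u u₀≈0 b (suc j) = trans (X.zeroʳ b (+ 0)) (coeff-0 (+ 0))
  constantTerm-Πinverse (suc n) u u₀≈0 b j = begin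
    coeff (b X.* X.Σ[0⋯ j ] (λ i → inverse u₁ i X.* g i)) (+ 0)
      ≈⟨ X.Σ-*ˡ j b (λ i → inverse u₁ i X.* g i) (+ 0) ⟩
    coeff (X.Σ[0⋯ j ] (λ i → b X.* (inverse u₁ i X.* g i))) (+ 0)
      ≈⟨ coeff-Σ j (λ i → b X.* (inverse u₁ i X.* g i)) (+ 0) ⟩
    Σ[0⋯ j ] (λ i → coeff (b X.* (inverse u₁ i X.* g i)) (+ 0))
      ≈⟨ Σ-cong-≤ j (λ i i≤j → coeff-*-inverse-* u₁ (u₀≈0 zero) b (g i) (+ 0) i≤j) ⟩
    Σ[0⋯ j ] (λ i → Σ[0⋯ j ] (λ k → (u₁ T.^ k) i * coeff (b′ k X.* g i) (+ 0)))
      ≈⟨ Σ-cong j (λ i → Σ-cong j (λ k → *-congˡ {(u₁ T.^ k) i} (hypothesis k (j ∸ i)))) ⟩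
    Σ[0⋯ j ] (λ i → Σ[0⋯ j ] (λ k → (u₁ T.^ k) i * E k (j ∸ i)))
      ≈⟨ Σ-swap j j (λ i k → (u₁ T.^ k) i * E k (j ∸ i)) ⟩
    eval (suc n) (H (suc n) p) u j  ∎
    where
    open Reasoning
    u₁ = u zero
    u′ = u ∘ suc
    g : ℕ → X.Carrier
    g i = Πinverse u′ (j ∸ i)
    -- Since b is arbitrary in the induction hypothesis, the power of x from the first factor can be
    -- absorbed into it; this shifts the exponents read from b by k + 1.
    b′ : ℕ → X.Carrier
    b′ k = b X.* monomial -[1+ k ] 1#
    p : ℕ → Carrier
    p k = coeff b (+ (suc n ℕ.+ k))
    E : ℕ → T.Carrier
    E k = eval n (H n (λ i → p (i ℕ.+ k))) u′
    index : ∀ i k → n ℕ.+ i ℕ.+ suc k ≡ suc n ℕ.+ (i ℕ.+ k)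
    index i k = ≡.trans (ℕ.+-suc (n ℕ.+ i) k) (≡.cong suc (ℕ.+-assoc n i k))
    hypothesis : ∀ k l → coeff (b′ k X.* Πinverse u′ l) (+ 0) ≈ E k l
    hypothesis k l = trans (constantTerm-Πinverse n u′ (u₀≈0 ∘ suc) (b′ k) l)
      (eval-cong n u′ (H-cong n λ i → trans (coeff-*-monomial b -[1+ k ] (+ (n ℕ.+ i)))
        (reflexive (≡.cong (λ d → coeff b (+ d)) (index i k)))) l)

  Πinverse-single : ∀ u j → Πinverse {1} (λ _ → u) j X.≈ inverse u j
  Πinverse-single u j = X.trans (XP.cauchy-comm (inverse u) (X.single X.1#) j) (XP.cauchy-identityˡ (inverse u) j)

  -- Reduces every coefficient to the constant term, the one place where the product is expanded.
  constantTerm-shift : ∀ f m → coeff f m ≈ coeff (f X.* monomial (ℤ.- m) 1#) (+ 0)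
  constantTerm-shift f m = sym (trans (coeff-*-monomial f (ℤ.- m) (+ 0)) (reflexive (≡.cong (coeff f) (lemma m))))
    where
    lemma : ∀ m → + 0 ℤ.- (ℤ.- m) ≡ m
    lemma = solve-∀

  coeff-*-swap : ∀ f g h m → coeff ((f X.* g) X.* h) m ≈ coeff ((f X.* h) X.* g) m
  coeff-*-swap f g h = X.trans (X.*-assoc f g h) (X.trans (X.*-congˡ {f} (X.*-comm g h)) (X.sym (X.*-assoc f h g)))

  coeff-const-zero : ∀ a k → coeff (const a) (+ suc k) ≈ 0#
  coeff-const-zero a k = reflexive (coeff-at (+ 0) (single a) (suc k))

  -- With at least one factor, Π 1/(x - uᵢ) has only negative exponents: the expansion reads the
  -- constant at exponents n + 1 + i + k, all positive.
  const-*-Πinverse-nonnegative : ∀ n (u : Vector T.Carrier (suc n)) → (∀ i → ZeroConstantTerm (u i)) → ∀ a j k →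
    coeff (const a X.* Πinverse u j) (+ k) ≈ 0#
  const-*-Πinverse-nonnegative n u u₀≈0 a j k = begin
    coeff (const a X.* Πinverse u j) (+ k)
      ≈⟨ constantTerm-shift (const a X.* Πinverse u j) (+ k) ⟩
    coeff ((const a X.* Πinverse u j) X.* x⁻ᵏ) (+ 0)
      ≈⟨ coeff-*-swap (const a) (Πinverse u j) x⁻ᵏ (+ 0) ⟩
    coeff ((const a X.* x⁻ᵏ) X.* Πinverse u j) (+ 0)
      ≈⟨ constantTerm-Πinverse (suc n) u u₀≈0 (const a X.* x⁻ᵏ) j ⟩
    eval (suc n) (H (suc n) (λ i → coeff (const a X.* x⁻ᵏ) (+ (suc n ℕ.+ i)))) u j
      ≈⟨ eval-zero (suc n) u (H-zero (suc n) λ i →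
           trans (coeff-*-monomial (const a) (ℤ.- (+ k)) (+ (suc n ℕ.+ i)))
           (trans (reflexive (≡.cong (λ m → coeff (const a) (+ (suc n ℕ.+ i) ℤ.+ m)) (ℤ.neg-involutive (+ k))))
                  (coeff-const-zero a (n ℕ.+ i ℕ.+ k)))) j ⟩
    0#  ∎
    where
    open Reasoning
    x⁻ᵏ = monomial (ℤ.- (+ k)) 1#

  -- These are the coefficients of xᵃ q. The zeros put in by `pad` are the coefficients of q at
  -- negative exponents.
  nonnegative-⊖ : ∀ q → (∀ m → m ℤ.< + 0 → coeff q m ≈ 0#) → ∀ a k → coeff q (k ℤ.⊖ a) ≈ pad a (nonnegative q) k
  nonnegative-⊖ q q≥0 zero    k       = refl
  nonnegative-⊖ q q≥0 (suc a) zero    = q≥0 -[1+ a ] ℤ.-<+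
  nonnegative-⊖ q q≥0 (suc a) (suc k) =
    trans (reflexive (≡.cong (coeff q) (ℤ.[1+m]⊖[1+n]≡m⊖n k a))) (nonnegative-⊖ q q≥0 a k)

  module _ (u : T.Carrier) (u₀≈0 : ZeroConstantTerm u) where
    open OneVariable u u₀≈0

    -- A formal Cauchy formula: the coefficient of x^(-1-a) in q/(x - u) is the residue of xᵃ q/(x -
    -- u), which is the value of xᵃ q at u.
    residue : ∀ q → (∀ m → m ℤ.< + 0 → coeff q m ≈ 0#) → ∀ a j →
      coeff (q X.* inverse u j) -[1+ a ] ≈ cauchy (u T.^ a) (eval₁ (nonnegative q)) j
    residue q q≥0 a j = begin
      coeff (q X.* inverse u j) -[1+ a ]
        ≈⟨ constantTerm-shift (q X.* inverse u j) -[1+ a ] ⟩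
      coeff ((q X.* inverse u j) X.* x¹⁺ᵃ) (+ 0)
        ≈⟨ coeff-*-swap q (inverse u j) x¹⁺ᵃ (+ 0) ⟩
      coeff ((q X.* x¹⁺ᵃ) X.* inverse u j) (+ 0)
        ≈⟨ X.*-congˡ {q X.* x¹⁺ᵃ} (Πinverse-single u j) (+ 0) ⟨
      coeff ((q X.* x¹⁺ᵃ) X.* Πinverse {1} (λ _ → u) j) (+ 0)
        ≈⟨ constantTerm-Πinverse 1 (λ _ → u) (λ _ → u₀≈0) (q X.* x¹⁺ᵃ) j ⟩
      eval₁ (λ k → coeff (q X.* x¹⁺ᵃ) (+ suc k)) j
        ≈⟨ eval-cong 1 (λ _ → u) (λ k → trans (coeff-*-monomial q (+ suc a) (+ suc k))
                                             (nonnegative-⊖ q q≥0 (suc a) (suc k))) j ⟩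
      eval₁ (pad a (nonnegative q)) j
        ≈⟨ eval₁-pad a (nonnegative q) j ⟩
      cauchy (u T.^ a) (eval₁ (nonnegative q)) j  ∎
      where
      open Reasoning
      x¹⁺ᵃ = monomial (+ suc a) 1#

    residue-const : ∀ c a j → coeff (const c X.* inverse u j) -[1+ a ] ≈ c * (u T.^ a) j
    residue-const c a j = begin
      coeff (const c X.* inverse u j) -[1+ a ]
        ≈⟨ residue (const c) (λ m m<0 → coeff-below (const c) m<0) a j ⟩
      cauchy (u T.^ a) (eval₁ (nonnegative (const c))) j
        ≈⟨ cauchy-cong {u T.^ a} (λ _ → refl)
             (λ l → trans (eval-cong 1 (λ _ → u) (λ k → reflexive (coeff-at (+ 0) (single c) k)) l) (eval₁-single c l)) j ⟩
      cauchy (u T.^ a) (single c) j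
        ≈⟨ trans (cauchy-comm (u T.^ a) (single c) j) (cauchy-single c (u T.^ a) j) ⟩
      c * (u T.^ a) j  ∎
      where open Reasoning

-- Reads off f / Π (x − uᵢ) = ∂_{u₁}f / Π_{i ≥ 2} (x − uᵢ) + f(u₁) / Π (x − uᵢ) at
-- coefficients to which the last term does not contribute.  R((x))((t)) is replaced
-- by a variable K because its operations unfold to terms of unmanageable size.
module DividedDifferenceRecursion {c ℓ c′ ℓ′}
  (K : RawRing c ℓ) (isCR : IsCommutativeRawRing K) (B : RawRing c′ ℓ′) (isCR′ : IsCommutativeRawRing B) where
  private
    module K = RawRing K
    module B = RawRing B

  module Recursion {i s a p} {Index : Set i} (coefficient : Index → K.Carrier → B.Carrier)
    (coefficient-cong : ∀ i {f g} → f K.≈ g → coefficient i f B.≈ coefficient i g)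
    (coefficient-+ : ∀ i f g → coefficient i (f K.+ g) B.≈ (coefficient i f B.+ coefficient i g))
    {Point : Set s} (Admissible : Point → Set a)
    (1/[x-_] : Point → K.Carrier) (value : Point → K.Carrier → K.Carrier)
    (NonNegative : K.Carrier → Set p)
    (∂-nonnegative : ∀ u {f} → Admissible u → NonNegative f →
      NonNegative ((f K.+ (K.- value u f)) K.* 1/[x- u ]))
    (value-vanishes : ∀ i n (u : Vector Point (suc n)) → (∀ j → Admissible (u j)) → ∀ f →
      coefficient i (value (u zero) f K.* Ops.product K (λ j → 1/[x- u j ])) B.≈ B.0#)
    where
    private
      module KP = RawRingProperties K isCR
      module BP = RawRingProperties B isCR′

    coefficient-*-Π : ∀ n (u : Vector Point n) → (∀ j → Admissible (u j)) → ∀ f → NonNegative f → ∀ i →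
      coefficient i (f K.* Ops.product K (λ j → 1/[x- u j ])) B.≈
      coefficient i (Vector.foldl (λ g v → (g K.+ (K.- value v g)) K.* 1/[x- v ]) f u)
    coefficient-*-Π zero    u u-adm f f≥0 i = coefficient-cong i (KP.*-identityʳ f)
    coefficient-*-Π (suc n) u u-adm f f≥0 i = begin
      coefficient i (f K.* (1/[x- v ] K.* Π))
        ≈⟨ coefficient-cong i (KP.*-split f (value v f) 1/[x- v ] Π) ⟩
      coefficient i ((∂f K.* Π) K.+ (value v f K.* (1/[x- v ] K.* Π)))
        ≈⟨ coefficient-+ i _ _ ⟩
      coefficient i (∂f K.* Π) B.+ coefficient i (value v f K.* (1/[x- v ] K.* Π))
        ≈⟨ BP.+-congˡ (value-vanishes i n u u-adm f) ⟩
      coefficient i (∂f K.* Π) B.+ B.0#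
        ≈⟨ BP.+-identityʳ _ ⟩
      coefficient i (∂f K.* Π)
        ≈⟨ coefficient-*-Π n (u ∘ suc) (u-adm ∘ suc) ∂f (∂-nonnegative v (u-adm zero) f≥0) i ⟩
      coefficient i (Vector.foldl (λ g w → (g K.+ (K.- value w g)) K.* 1/[x- w ]) f u)  ∎
      where
      open BP.Reasoning
      v  = u zero
      ∂f = (f K.+ (K.- value v f)) K.* 1/[x- v ]
      Π  = KP.product (λ j → 1/[x- u (suc j) ])

    ∂s-nonnegative : ∀ n (u : Vector Point n) → (∀ j → Admissible (u j)) → ∀ f → NonNegative f →
      NonNegative (Vector.foldl (λ g v → (g K.+ (K.- value v g)) K.* 1/[x- v ]) f u)
    ∂s-nonnegative zero    u u-adm f f≥0 = f≥0
    ∂s-nonnegative (suc n) u u-adm f f≥0 =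
      ∂s-nonnegative n (u ∘ suc) (u-adm ∘ suc) _ (∂-nonnegative (u zero) (u-adm zero) f≥0)

-- The two formulas

module Main {c ℓ} (R : CommutativeRing c ℓ) where
  open Setup R
  open Variables R
  open Evaluation R
  open Residues R
  private
    isCR = CommutativeRing.isCommutativeRing R
    module T  = RawRingProperties R⟦t⟧ (PowerSeriesProperties.powerSeries-isCR rawRing isCR)
    isCR-x = LaurentProperties.laurent-isCR rawRing isCR
    module X  = RawRingProperties R⦅x⦆ isCR-x
    module XP = PowerSeriesProperties R⦅x⦆ isCR-x
    module LX = LaurentProperties R⦅x⦆ isCR-x
    module Xt = LaurentOps R⦅x⦆
    module XT = RawRingProperties R⦅x⦆⦅t⦆ LX.laurent-isCR
  open RawRingProperties rawRing isCR
  open PowerSeriesProperties rawRing isCR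
  open PowerSeriesOps rawRing using (X; Σ∞)
  open Convergence rawRing isCR
  open LaurentProperties rawRing isCR
  open LaurentOps rawRing

  coeffₓₜ : XT.Carrier → ℤ → ℤ → Carrier
  coeffₓₜ f n m = coeff (Xt.coeff f n) m

  coeff-PT-nonnegative : ∀ f n k → coeffₓₜ (PTₓ f) n (+ k) ≈ coeffₓₜ f n (+ k)
  coeff-PT-nonnegative f n k with n ℤ.- order f
  ... | + l      = reflexive (coeff-at (+ 0) (nonnegative (coeffs f l)) k)
  ... | -[1+ _ ] = refl

  coeff-PT-negative : ∀ f n k → coeffₓₜ (PTₓ f) n -[1+ k ] ≈ 0#
  coeff-PT-negative f n k with n ℤ.- order f
  ... | + l      = refl
  ... | -[1+ _ ] = coeff-0 -[1+ k ]

  coeff-Σ-* : ∀ F G l m → coeff (X.cauchy F G l) m ≈ Σ[0⋯ l ] (λ i → coeff (F i X.* G (l ∸ i)) m)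
  coeff-Σ-* F G l m = coeff-Σ l (λ i → F i X.* G (l ∸ i)) m

  coeffₓₜ-⟨⟩-cong : ∀ o F G m → (∀ l → coeff (F l) m ≈ coeff (G l) m) →
                    ∀ n → coeffₓₜ (o ⟨ F ⟩) n m ≈ coeffₓₜ (o ⟨ G ⟩) n m
  coeffₓₜ-⟨⟩-cong o F G m F≈G n with n ℤ.- o
  ... | + l      = F≈G l
  ... | -[1+ _ ] = refl

  coeffₓₜ-⟨⟩-zero : ∀ o F m → (∀ l → coeff (F l) m ≈ 0#) → ∀ n → coeffₓₜ (o ⟨ F ⟩) n m ≈ 0#
  coeffₓₜ-⟨⟩-zero o F m F≈0 n with n ℤ.- o
  ... | + l      = F≈0 l
  ... | -[1+ _ ] = coeff-0 m

  coeffs≥0 : ∀ {f} → OnlyNonnegativePowersOfx f → ∀ l m → m ℤ.< + 0 → coeff (coeffs f l) m ≈ 0#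
  coeffs≥0 {f} f≥0 l m m<0 = trans (sym (reflexive (≡.cong (λ a → coeff a m) (LX.coeff-at (order f) (coeffs f) l))))
                                   (f≥0 (order f ℤ.+ + l) m m<0)

  module _ (u : T.Carrier) (u₀≈0 : ZeroConstantTerm u) where
    open OneVariable u u₀≈0

    -- The coefficients of x^{−1−a} in f/(x − u) and in f(u)/(x − u) are both f(u) uᵃ.
    ∂-numerators : ∀ {f} → OnlyNonnegativePowersOfx f → ∀ n a →
      coeffₓₜ (f XT.* 1/[x- u ]) n -[1+ a ] ≈ coeffₓₜ (R⦅t⦆→R⦅x⦆⦅t⦆ (f ⟨x≔ u ⟩) XT.* 1/[x- u ]) n -[1+ a ]
    ∂-numerators {f} f≥0 n a =
      -- Substituting u keeps the order in t, so both products have the same order and only their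
      -- coefficient sequences remain to be compared.
      coeffₓₜ-⟨⟩-cong (order f ℤ.+ + 0) (X.cauchy q (inverse u)) (X.cauchy (const ∘ F) (inverse u))
        -[1+ a ] equal n
      where
      open Reasoning
      q = coeffs f
      E : ℕ → T.Carrier
      E i = eval₁ (nonnegative (q i))
      -- The coefficients of f(u), counted from t^(order f). Pulling uᵃ out of the sum of the
      -- residues leaves exactly this series.
      F : T.Carrier
      F = Σ∞ (λ i → cauchy (X T.^ i) (E i))
      swap : ∀ i → cauchy (X T.^ i) (cauchy (u T.^ a) (E i)) ≋ cauchy (u T.^ a) (cauchy (X T.^ i) (E i))
      swap i = T.trans (T.sym (T.*-assoc (X T.^ i) (u T.^ a) (E i)))
        (T.trans (T.*-congʳ {E i} (T.*-comm (X T.^ i) (u T.^ a))) (T.*-assoc (u T.^ a) (X T.^ i) (E i)))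
      equal : ∀ l → coeff (X.cauchy q (inverse u) l) -[1+ a ] ≈ coeff (X.cauchy (const ∘ F) (inverse u) l) -[1+ a ]
      equal l = begin
        coeff (X.cauchy q (inverse u) l) -[1+ a ]
          ≈⟨ coeff-Σ-* q (inverse u) l -[1+ a ] ⟩
        Σ[0⋯ l ] (λ i → coeff (q i X.* inverse u (l ∸ i)) -[1+ a ])
          ≈⟨ Σ-cong l (λ i → residue u u₀≈0 (q i) (coeffs≥0 {f} f≥0 i) a (l ∸ i)) ⟩
        Σ[0⋯ l ] (λ i → cauchy (u T.^ a) (E i) (l ∸ i))
          ≈⟨ Σ∞-X^ (λ i → cauchy (u T.^ a) (E i)) l ⟨
        Σ∞ (λ i → cauchy (X T.^ i) (cauchy (u T.^ a) (E i))) l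
          ≈⟨ Σ∞-cong {λ i → cauchy (X T.^ i) (cauchy (u T.^ a) (E i))} swap l ⟩
        Σ∞ (λ i → cauchy (u T.^ a) (cauchy (X T.^ i) (E i))) l
          ≈⟨ cauchy-Σ∞ (u T.^ a) (λ i → cauchy (X T.^ i) (E i)) (λ i → X^*-vanishesBelow i (E i)) l ⟨
        cauchy (u T.^ a) F l
          ≈⟨ cauchy-comm (u T.^ a) F l ⟩
        cauchy F (u T.^ a) l
          ≈⟨ Σ-cong l (λ i → residue-const u u₀≈0 (F i) a (l ∸ i)) ⟨
        Σ[0⋯ l ] (λ i → coeff (const (F i) X.* inverse u (l ∸ i)) -[1+ a ])
          ≈⟨ coeff-Σ-* (const ∘ F) (inverse u) l -[1+ a ] ⟨
        coeff (X.cauchy (const ∘ F) (inverse u) l) -[1+ a ]  ∎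

    ∂-nonnegative : ∀ {f} → OnlyNonnegativePowersOfx f → OnlyNonnegativePowersOfx (∂ u f)
    ∂-nonnegative {f} f≥0 n (+ k) (ℤ.+<+ ())
    ∂-nonnegative {f} f≥0 n -[1+ a ] _ = begin
      coeffₓₜ ((f XT.- g) XT.* 1/[x- u ]) n -[1+ a ]
        ≈⟨ XT.[y-z]x≈yx-zx 1/[x- u ] f g n -[1+ a ] ⟩
      coeffₓₜ ((f XT.* 1/[x- u ]) XT.- (g XT.* 1/[x- u ])) n -[1+ a ]
        ≈⟨ LX.coeff-+ (f XT.* 1/[x- u ]) (XT.- (g XT.* 1/[x- u ])) n -[1+ a ] ⟩
      coeff (Xt.coeff (f XT.* 1/[x- u ]) n X.+ Xt.coeff (XT.- (g XT.* 1/[x- u ])) n) -[1+ a ]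
        ≈⟨ coeff-+ (Xt.coeff (f XT.* 1/[x- u ]) n) (Xt.coeff (XT.- (g XT.* 1/[x- u ])) n) -[1+ a ] ⟩
      coeffₓₜ (f XT.* 1/[x- u ]) n -[1+ a ] + coeffₓₜ (XT.- (g XT.* 1/[x- u ])) n -[1+ a ]
        ≈⟨ +-cong (∂-numerators f≥0 n a)
             (trans (LX.coeff-neg (g XT.* 1/[x- u ]) n -[1+ a ])
                    (coeff-neg (Xt.coeff (g XT.* 1/[x- u ]) n) -[1+ a ])) ⟩
      coeffₓₜ (g XT.* 1/[x- u ]) n -[1+ a ] - coeffₓₜ (g XT.* 1/[x- u ]) n -[1+ a ]
        ≈⟨ -‿inverseʳ _ ⟩
      0#  ∎
      where
      open Reasoning
      g = R⦅t⦆→R⦅x⦆⦅t⦆ (f ⟨x≔ u ⟩)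

  const-*-Π-nonnegative : ∀ n (u : Vector T.Carrier (suc n)) → (∀ i → ZeroConstantTerm (u i)) → ∀ g m k →
    coeffₓₜ (R⦅t⦆→R⦅x⦆⦅t⦆ g XT.* Π1/[x- u ]) m (+ k) ≈ 0#
  const-*-Π-nonnegative n u u₀≈0 g m k =
    ≡.subst (λ Π → coeffₓₜ (R⦅t⦆→R⦅x⦆⦅t⦆ g XT.* Π) m (+ k) ≈ 0#) (≡.sym (Π1/[x-]≡ u)) vanishes
    where
    vanishes : coeffₓₜ (R⦅t⦆→R⦅x⦆⦅t⦆ g XT.* Xt.fromPowerSeries (Πinverse u)) m (+ k) ≈ 0#
    vanishes = coeffₓₜ-⟨⟩-zero (order g ℤ.+ + 0) (X.cauchy (const ∘ coeffs g) (Πinverse u)) (+ k)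
      (λ l → trans (coeff-Σ-* (const ∘ coeffs g) (Πinverse u) l (+ k))
        (Σ-zero l (λ i → const-*-Πinverse-nonnegative n u u₀≈0 (coeffs g i) (l ∸ i) k))) m

  coeffₓₜ-+ : ∀ f g n m → coeffₓₜ (f XT.+ g) n m ≈ coeffₓₜ f n m + coeffₓₜ g n m
  coeffₓₜ-+ f g n m = trans (LX.coeff-+ f g n m) (coeff-+ (Xt.coeff f n) (Xt.coeff g n) m)

  open DividedDifferenceRecursion R⦅x⦆⦅t⦆ LX.laurent-isCR rawRing isCR

  open Recursion {Index = ℤ × ℕ}
    (λ (n , k) f → coeffₓₜ f n (+ k)) (λ (n , k) f≈g → f≈g n (+ k)) (λ (n , k) f g → coeffₓₜ-+ f g n (+ k))
    ZeroConstantTerm 1/[x-_] (λ u f → R⦅t⦆→R⦅x⦆⦅t⦆ (f ⟨x≔ u ⟩))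
    OnlyNonnegativePowersOfx (λ u u₀≈0 → ∂-nonnegative u u₀≈0)
    (λ (m , k) n u u₀≈0 f → const-*-Π-nonnegative n u u₀≈0 (f ⟨x≔ u zero ⟩) m k)

  PT-*-Π : ∀ n (u : Vector T.Carrier n) → (∀ i → ZeroConstantTerm (u i)) → ∀ f → OnlyNonnegativePowersOfx f →
    RawRing._≈_ R⦅x⦆⦅t⦆ (PTₓ (RawRing._*_ R⦅x⦆⦅t⦆ f Π1/[x- u ])) (∂s u f)
  PT-*-Π n u u₀≈0 f f≥0 m (+ k) = trans (coeff-PT-nonnegative (RawRing._*_ R⦅x⦆⦅t⦆ f Π1/[x- u ]) m k)
    (coefficient-*-Π n u u₀≈0 f f≥0 (m , k))
  PT-*-Π n u u₀≈0 f f≥0 m -[1+ k ] = trans (coeff-PT-negative (RawRing._*_ R⦅x⦆⦅t⦆ f Π1/[x- u ]) m k)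
    (sym (∂s-nonnegative n u u₀≈0 f f≥0 m -[1+ k ] ℤ.-<+))

  open PartialFractionSum R using (divided; partialFractionSum)

  -- Expanding the product on the left and unfolding `divided` on the right both lead to Σₘ qₘ
  -- hₘ₋ₙ(u₁,...,uₙ₊₁), for each coefficient q of f in t.
  CT-*-Π : ∀ n (u : Vector T.Carrier (suc n)) → (∀ i → ZeroConstantTerm (u i)) → ∀ f →
    RawRing._≈_ R⦅t⦆ (CTₓ ((x XT.* f) XT.* Π1/[x- u ])) (substitute (suc n) (mapCoeffs (divided n) f) u)
  CT-*-Π n u u₀≈0 f = ≡.subst
    (λ Π → RawRing._≈_ R⦅t⦆ (CTₓ ((x XT.* f) XT.* Π)) (substitute (suc n) (mapCoeffs (divided n) f) u))
    (≡.sym (Π1/[x-]≡ u))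
    (⟨⟩-cong (≡.trans (ℤ.+-identityʳ _) (ℤ.+-identityˡ (order f))) constantTerm)
    where
    open Reasoning
    q = coeffs f
    x₁ = monomial (+ 1) 1#
    xq : ℕ → X.Carrier
    xq = X.cauchy (X.single x₁) q
    E : ℕ → T.Carrier
    E i = eval (suc n) (divided n (q i)) u
    -- The expansion of n + 1 factors starts reading at exponent n + 1; the factor x lowers this to
    -- n, the offset in `divided`.
    coeff-xq : ∀ i k → coeff (xq i) (+ (suc n ℕ.+ k)) ≈ coeff (q i) (+ (k ℕ.+ n))
    coeff-xq i k = begin
      coeff (xq i) (+ (suc n ℕ.+ k))
        ≈⟨ X.trans (XP.cauchy-single x₁ q i) (X.*-comm x₁ (q i)) (+ (suc n ℕ.+ k)) ⟩
      coeff (q i X.* x₁) (+ (suc n ℕ.+ k))      ≈⟨ coeff-*-monomial (q i) (+ 1) (+ (suc n ℕ.+ k)) ⟩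
      coeff (q i) (+ (n ℕ.+ k))                 ≡⟨ ≡.cong (λ j → coeff (q i) (+ j)) (ℕ.+-comm n k) ⟩
      coeff (q i) (+ (k ℕ.+ n))                 ∎
    constantTerm : ∀ l → coeff (X.cauchy xq (Πinverse u) l) (+ 0) ≈ Σ∞ (λ i → cauchy (X T.^ i) (E i)) l
    constantTerm l = begin
      coeff (X.cauchy xq (Πinverse u) l) (+ 0)
        ≈⟨ coeff-Σ-* xq (Πinverse u) l (+ 0) ⟩
      Σ[0⋯ l ] (λ i → coeff (xq i X.* Πinverse u (l ∸ i)) (+ 0))
        ≈⟨ Σ-cong l (λ i → trans (constantTerm-Πinverse (suc n) u u₀≈0 (xq i) (l ∸ i))
             (eval-cong (suc n) u (H-cong (suc n) (coeff-xq i)) (l ∸ i))) ⟩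
      Σ[0⋯ l ] (λ i → E i (l ∸ i))
        ≈⟨ Σ∞-X^ E l ⟨
      Σ∞ (λ i → cauchy (X T.^ i) (E i)) l  ∎

mainTheorem3 : ∀ {c ℓ} (R : CommutativeRing c ℓ) →
    let open Setup R
        open RawRing using (Carrier)
        open RawRing R⦅x⦆⦅t⦆ using (_*_) renaming (_≈_ to _≈ˣᵗ_)
        open RawRing R⦅t⦆ using () renaming (_≈_ to _≈ᵗ_)
    in
    (n : ℕ) (u : Vector (Carrier R⟦t⟧) (suc n)) →
    (∀ i → ZeroConstantTerm (u i)) →
    (Q : Carrier R⦅x⦆⦅t⦆) → OnlyNonnegativePowersOfx Q →
    (PTₓ (Q * Π1/[x- u ]) ≈ˣᵗ ∂s u Q)
    ×
    (Σ[ P ∈ ∃! (RawRing._≈_ (R⟦z⟧⦅t⦆ (suc n))) (IsPartialFractionSum n Q) ]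
      (CTₓ (x * Q * Π1/[x- u ]) ≈ᵗ substitute (suc n) (proj₁ P) u))
mainTheorem3 R n u u₀≈0 Q Q≥0 =
    Main.PT-*-Π R (suc n) u u₀≈0 Q Q≥0
  , PartialFractionSum.partialFractionSum R n Q
  , Main.CT-*-Π R n u u₀≈0 Q
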